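{- Let $T(z,w)=\sum_{n\ge1}\sum_{t\ge0}T(n,t)\,w^t z^n$. Let $C(x)=\frac{1-\sqrt{1-4x}}{2x}$, and define $\rho_0(z)=C(z(1-w))$ and, for $j\ge1$, $\rho_j(z)=C\!\left(z(1-w)\prod_{i=0}^{j-1}\rho_i(z)\right)$. Then $$T(z,w)=\sum_{j\ge0}(\rho_j(z)-1)\,w^j\prod_{i=0}^{j-1}\rho_i(z).$$
   Context: Multi-pass stack sorting: in a pass, the entries of the current input are pushed one at a time, in order, onto a stack; whenever the top of the stack is the smallest value not yet output, it is popped to the output (repeatedly); entries are never popped otherwise. When all input entries have been pushed and no pop is possible, if the stack is nonempty the remaining entries are returned to the input in their original relative order and a new pass begins. The tier of a permutation is one less than the minimum number of passes needed to output $1,\dots,n$. $T(n,t)$ denotes the number of permutations of length $n$ with tier $t$. $C(x)$ is the generating function of the Catalan numbers $\frac{1}{n+1}\binom{2n}{n}$ (a formal power series in $x$), and the identity is an identity of formal power series in $z$ and $w$. -}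

module Defs where

open import Data.Nat as ℕ using (ℕ; zero; suc; _∸_; _≡ᵇ_)
open import Data.Nat.Combinatorics using (_C_)
open import Data.Nat.DivMod using (_/_)
open import Data.Integer as ℤ using (ℤ; +_)
open import Data.Bool using (if_then_else_)
open import Data.Product using (_×_; _,_)
open import Data.List using (List; []; _∷_; reverse; length; filter; map; concatMap; upTo)
open import Data.List.Relation.Unary.Unique.DecPropositional ℕ._≟_ using (unique?)

-- Pop from the stack (head = top) while the top equals m, the smallest
-- value not yet output.  Returns the new "next value" and the stack.
popAll : ℕ → List ℕ → ℕ × List ℕ
popAll m [] = m , []
popAll m (x ∷ s) = if x ≡ᵇ m then popAll (suc m) s else (m , x ∷ s)

-- One pass: push the input entries in order, popping greedily.
-- Returns the next value to output and the leftover entries in their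
-- original relative order (= the stack read from bottom to top).
passFrom : ℕ → List ℕ → List ℕ → ℕ × List ℕ
passFrom m stack [] = m , reverse stack
passFrom m stack (x ∷ xs) with popAll m (x ∷ stack)
... | m' , s' = passFrom m' s' xs

pass : ℕ → List ℕ → ℕ × List ℕ
pass m xs = passFrom m [] xs

-- Number of passes until the input is exhausted, with a fuel bound.
-- (Each pass on a nonempty input outputs at least one entry, so
-- fuel = length of the permutation always suffices.)
passesFuel : ℕ → ℕ → List ℕ → ℕ
passesFuel _ m [] = 0
passesFuel zero m (_ ∷ _) = 0
passesFuel (suc f) m xs@(_ ∷ _) with pass m xs
... | m' , rest = suc (passesFuel f m' rest)

passes : List ℕ → ℕ
passes π = passesFuel (length π) 1 π

tier : List ℕ → ℕ
tier π = passes π ∸ 1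

words : ℕ → ℕ → List (List ℕ)
words zero n = [] ∷ []
words (suc len) n = concatMap (λ x → map (x ∷_) (words len n)) (map suc (upTo n))

perms : ℕ → List (List ℕ)
perms n = filter unique? (words n n)

T : ℕ → ℕ → ℕ
T n t = length (filter (λ π → tier π ℕ.≟ t) (perms n))

-- Formal power series in z and w with integer coefficients:
-- f n t is the coefficient of z^n w^t.

Series : Set
Series = ℕ → ℕ → ℤ

sumTo : ℕ → (ℕ → ℤ) → ℤ
sumTo zero f = f 0
sumTo (suc n) f = sumTo n f ℤ.+ f (suc n)

_⊕_ : Series → Series → Series
(f ⊕ g) n t = f n t ℤ.+ g n t

_⊖_ : Series → Series → Series
(f ⊖ g) n t = f n t ℤ.- g n t

_⊗_ : Series → Series → Series
(f ⊗ g) n t = sumTo n (λ a → sumTo t (λ b → f a b ℤ.* g (n ∸ a) (t ∸ b)))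

infixl 7 _⊗_
infixl 6 _⊕_ _⊖_

𝟙 : Series
𝟙 zero zero = + 1
𝟙 _ _ = + 0

zS : Series
zS 1 zero = + 1
zS _ _ = + 0

wS : Series
wS zero 1 = + 1
wS _ _ = + 0

pow : Series → ℕ → Series
pow f zero = 𝟙
pow f (suc k) = f ⊗ pow f k

catalan : ℕ → ℕ
catalan k = ((2 ℕ.* k) C k) / suc k

-- Composition C(g) = Σ_k catalan k · g^k, for a series g with no z^0
-- terms (then only k ≤ n contributes to the coefficient of z^n).
Cat∘ : Series → Series
Cat∘ g n t = sumTo n (λ k → + catalan k ℤ.* pow g k n t)

mutual
  ρ : ℕ → Series
  ρ j = Cat∘ (zS ⊗ (𝟙 ⊖ wS) ⊗ P j)

  P : ℕ → Series
  P zero = 𝟙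
  P (suc j) = P j ⊗ ρ j

Tseries : Series
Tseries zero t = + 0
Tseries (suc n) t = + T (suc n) t

-- Σ_{j≥0} (ρ_j - 1) w^j ∏_{i<j} ρ_i ; only j ≤ t contributes to w^t.
RHS : Series
RHS n t = sumTo t (λ j → ((ρ j ⊖ 𝟙) ⊗ pow wS j ⊗ P j) n t)

{-# OPTIONS --safe #-}
-- Removing the entries of a permutation from the smallest up encodes it as an inversion sequence
-- e (for each value, the number of larger entries to its right), and the pass that outputs m ends
-- before m+1 exactly when m was inserted to the right of m+1 and not next to it; hence the tier
-- is the number of descents of e.  Write Tₙ(w) for the descent polynomials, v = 1 − w and
-- Ψ(X) = Σ Tₙ zⁿ Xⁿ⁺¹.  Recording the newest entry by a second variable and applying the kernel
-- method gives Ψ(X − zvX²) = w Ψ(X) + vX.  Since ρⱼ = 1 + zv Pⱼ ρⱼ² with Pⱼ = ρ₀⋯ρⱼ₋₁, we have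
-- Pⱼ = Pⱼ₊₁ − zv Pⱼ₊₁², so iterating the equation at X = P₁, P₂, … expands Ψ(P₀) = Ψ(1) into 1
-- plus the required sum.
module Submission where

open import Defs
open import Data.Nat using (ℕ)
open import Relation.Binary.PropositionalEquality using (_≡_)

open import Algebra.Bundles using (AbelianGroup; CommutativeRing)
import Algebra.Construct.Pointwise as Pointwise
import Algebra.Properties.CommutativeSemigroup as CommutativeSemigroupProperties
import Algebra.Properties.CommutativeSemiring.Exp as CommutativeExp
import Algebra.Properties.Group as GroupProperties
import Algebra.Properties.Semiring.Exp as Exp
import Algebra.Properties.Semiring.Sum as Sum
import Algebra.Solver.Ring as RingSolver
open import Algebra.Solver.Ring.AlmostCommutativeRing using (fromCommutativeRing; _-Raw-AlmostCommutative⟶_)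
open import Data.Bool using (true; false; if_then_else_)
open import Data.Fin as Fin using (Fin; toℕ; fromℕ<)
import Data.Fin.Properties as Finₚ
open import Data.Integer as ℤ using (ℤ; +_; -[1+_]; +[1+_])
import Data.Integer.Properties as ℤₚ
import Data.Integer.Tactic.RingSolver as ℤSolver
open import Data.List using (List; []; _∷_; _++_; _ʳ++_; length; take; drop; reverse; map; concatMap; upTo; allFin; tabulate; filter; cartesianProductWith)
import Data.List.Properties as Listₚ
open import Data.List.Membership.DecPropositional Data.Nat._≟_ using (_∈?_)
open import Data.List.Membership.Propositional using (_∈_; _∉_)
open import Data.List.Membership.Propositional.Properties
  using (∈-∃++; ∈-map⁺; ∈-map⁻; ∈-upTo⁺; ∈-upTo⁻; ∈-allFin; ∈-filter⁺; ∈-filter⁻; ∈-cartesianProductWith⁺; ∈-cartesianProductWith⁻)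
open import Data.List.Membership.Propositional.Properties.WithK using (unique∧set⇒bag)
open import Data.List.Relation.Binary.BagAndSetEquality using (∼bag⇒↭)
open import Data.List.Relation.Binary.Permutation.Propositional using (_↭_; ↭-sym; ↭-trans; ↭-prep; ↭-reflexive; ↭⇒↭ₛ)
open import Data.List.Relation.Binary.Permutation.Propositional.Properties using (All-resp-↭; ↭-length; filter-↭; shift)
import Data.List.Relation.Binary.Permutation.Setoid.Properties as SetoidPermutation
open import Data.List.Relation.Unary.All as All using (All; []; _∷_)
import Data.List.Relation.Unary.All.Properties as Allₚ
open import Data.List.Relation.Unary.AllPairs using ([]; _∷_)
open import Data.List.Relation.Unary.Any using (here)
open import Data.List.Relation.Unary.Unique.DecPropositional Data.Nat._≟_ using (unique?)
open import Data.List.Relation.Unary.Unique.Propositional using (Unique)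
import Data.List.Relation.Unary.Unique.Propositional.Properties as Uniqueₚ
import Data.Maybe as Maybe
open import Data.Nat as ℕ using (zero; suc; _∸_; _≡ᵇ_; _≤_; _<_; z≤n; s≤s)
open import Data.Nat.Combinatorics using (_C_; nC1≡n; nCk+nC[k+1]≡[n+1]C[k+1]; nCk≡nC[n∸k]; k>n⇒nCk≡0)
open import Data.Nat.Divisibility using (_∣_; ∣m+n∣m⇒∣n; m∣m*n)
open import Data.Nat.DivMod using (m*[n/m]≡n)
import Data.Nat.Properties as ℕₚ
import Data.Nat.Tactic.RingSolver as ℕSolver
open import Data.Product using (_×_; _,_; ∃)
open import Data.Sum using (_⊎_; inj₁; inj₂)
open import Function using (_∘_; flip; id; mk⇔)
import Relation.Binary.PropositionalEquality as ≡
import Relation.Binary.Reasoning.Setoid as SetoidReasoning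
open import Relation.Nullary using (yes; no; contradiction)
open import Relation.Nullary.Decidable using (dec⇒maybe)

-- Power series over a commutative ring

-- All infinite sums are truncated: `Ψ m` keeps the terms n < m, the functional equation then
-- carries an explicit error divisible by z^m, and J iterations leave a tail divisible by w^J. The
-- coefficient of z^n w^t sees neither once m > n and J > t. Every question of convergence becomes
-- one of divisibility, and the algebra takes place at arbitrary elements z, w of a commutative
-- ring. The kernel method in its plain form fixes x = 1 - zv and gives a single equation. Weighting
-- the n-th term by X^(n+1) changes the kernel to 1 - x = zvX with X free, and this freedom is what
-- lets the equation be applied again to its own right-hand side. Because w + v = 1, it can be
-- written as Ψ(P_j) - P_j = w (Ψ(P_(j+1)) - P_(j+1)) + (P_(j+1) - P_j), and the last bracket is
-- (ρ_j - 1) P_j, the shape of the required summand.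

module PowerSeries {c ℓ} (R : CommutativeRing c ℓ) where
  open CommutativeRing R
  open SetoidReasoning setoid
  open CommutativeSemigroupProperties +-commutativeSemigroup using (interchange)

  infixl 7 _⊛_
  -- Peeling off the constant coefficient of the left factor makes the Cauchy product structurally
  -- recursive, so the ring laws follow by induction on the degree without reindexing sums. `⊗≈⊛`
  -- identifies it with the product of the statement.
  _⊛_ : (ℕ → Carrier) → (ℕ → Carrier) → (ℕ → Carrier)
  (f ⊛ g) zero = f 0 * g 0
  (f ⊛ g) (suc n) = f 0 * g (suc n) + ((f ∘ suc) ⊛ g) n

  one : ℕ → Carrier
  one zero = 1#
  one (suc _) = 0#

  ⊛-cong : ∀ {f f′ g g′} → (∀ n → f n ≈ f′ n) → (∀ n → g n ≈ g′ n) → ∀ n → (f ⊛ g) n ≈ (f′ ⊛ g′) n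
  ⊛-cong p q zero = *-cong (p 0) (q 0)
  ⊛-cong p q (suc n) = +-cong (*-cong (p 0) (q (suc n))) (⊛-cong (p ∘ suc) q n)

  zero-⊛ : ∀ f n → ((λ _ → 0#) ⊛ f) n ≈ 0#
  zero-⊛ f zero = zeroˡ _
  zero-⊛ f (suc n) = trans (+-cong (zeroˡ _) (zero-⊛ f n)) (+-identityˡ 0#)

  ⊛-identityˡ : ∀ f n → (one ⊛ f) n ≈ f n
  ⊛-identityˡ f zero = *-identityˡ _
  ⊛-identityˡ f (suc n) = trans (+-cong (*-identityˡ _) (zero-⊛ f n)) (+-identityʳ _)

  ⊛-distribʳ : ∀ h f g n → ((λ k → f k + g k) ⊛ h) n ≈ (f ⊛ h) n + (g ⊛ h) n
  ⊛-distribʳ h f g zero = distribʳ _ _ _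
  ⊛-distribʳ h f g (suc n) = trans (+-cong (distribʳ _ _ _) (⊛-distribʳ h (f ∘ suc) (g ∘ suc) n)) (interchange _ _ _ _)

  scale-⊛ : ∀ a f g n → ((λ k → a * f k) ⊛ g) n ≈ a * (f ⊛ g) n
  scale-⊛ a f g zero = *-assoc _ _ _
  scale-⊛ a f g (suc n) = trans (+-cong (*-assoc _ _ _) (scale-⊛ a (f ∘ suc) g n)) (sym (distribˡ _ _ _))

  -- The mirror image of the defining recursion, peeling the right factor; commutativity rests on
  -- it.
  ⊛-suc : ∀ f g n → (f ⊛ g) (suc n) ≈ (f ⊛ (g ∘ suc)) n + f (suc n) * g 0
  ⊛-suc f g zero = refl
  ⊛-suc f g (suc n) = trans (+-congˡ (⊛-suc (f ∘ suc) g n)) (sym (+-assoc _ _ _))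

  ⊛-comm : ∀ f g n → (f ⊛ g) n ≈ (g ⊛ f) n
  ⊛-comm f g zero = *-comm _ _
  ⊛-comm f g (suc n) = begin
    f 0 * g (suc n) + ((f ∘ suc) ⊛ g) n ≈⟨ +-cong (*-comm _ _) (⊛-comm (f ∘ suc) g n) ⟩
    g (suc n) * f 0 + (g ⊛ (f ∘ suc)) n ≈⟨ +-comm _ _ ⟩
    (g ⊛ (f ∘ suc)) n + g (suc n) * f 0 ≈⟨ ⊛-suc g f n ⟨
    (g ⊛ f) (suc n)                     ∎

  ⊛-assoc : ∀ f g h n → ((f ⊛ g) ⊛ h) n ≈ (f ⊛ (g ⊛ h)) n
  ⊛-assoc f g h zero = *-assoc _ _ _
  ⊛-assoc f g h (suc n) = begin
    f 0 * g 0 * h (suc n) + ((λ k → f 0 * g (suc k) + ((f ∘ suc) ⊛ g) k) ⊛ h) n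
      ≈⟨ +-cong (*-assoc _ _ _) (⊛-distribʳ h _ _ n) ⟩
    f 0 * (g 0 * h (suc n)) + (((λ k → f 0 * g (suc k)) ⊛ h) n + (((f ∘ suc) ⊛ g) ⊛ h) n)
      ≈⟨ +-congˡ (+-cong (scale-⊛ (f 0) (g ∘ suc) h n) (⊛-assoc (f ∘ suc) g h n)) ⟩
    f 0 * (g 0 * h (suc n)) + (f 0 * ((g ∘ suc) ⊛ h) n + ((f ∘ suc) ⊛ (g ⊛ h)) n)
      ≈⟨ +-assoc _ _ _ ⟨
    f 0 * (g 0 * h (suc n)) + f 0 * ((g ∘ suc) ⊛ h) n + ((f ∘ suc) ⊛ (g ⊛ h)) n
      ≈⟨ +-congʳ (distribˡ _ _ _) ⟨
    f 0 * (g ⊛ h) (suc n) + ((f ∘ suc) ⊛ (g ⊛ h)) n ∎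

  commutativeRing : CommutativeRing c ℓ
  commutativeRing = record
    { _*_ = _⊛_
    ; 1# = one
    ; isCommutativeRing = record
      { isRing = record
        { +-isAbelianGroup = isAbelianGroup
        ; *-cong = ⊛-cong
        ; *-assoc = ⊛-assoc
        ; *-identity = ⊛-identityˡ , λ f n → trans (⊛-comm f one n) (⊛-identityˡ f n)
        ; distrib = (λ h f g n → trans (⊛-comm h _ n) (trans (⊛-distribʳ h f g n) (+-cong (⊛-comm f h n) (⊛-comm g h n)))) , ⊛-distribʳ
        }
      ; *-comm = ⊛-comm
      }
    }
    where open AbelianGroup (Pointwise.abelianGroup ℕ +-abelianGroup) using (isAbelianGroup)

-- Ring solving with integer coefficients

module IntegerCoefficients {c ℓ} (R : CommutativeRing c ℓ) where
  open CommutativeRing R hiding (zero)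
  open SetoidReasoning setoid
  open import Algebra.Properties.Semiring.Mult.TCOptimised semiring using (×-homo-+; 1+×) renaming (_×_ to _×ᵣ_)
  open import Algebra.Properties.Ring ring
  open CommutativeSemigroupProperties +-commutativeSemigroup using (interchange)

  ⟦_⟧ : ℤ → Carrier
  ⟦ + n ⟧      = n ×ᵣ 1#
  ⟦ -[1+ n ] ⟧ = - (suc n ×ᵣ 1#)

  ⊖-homo : ∀ m n → ⟦ m ℤ.⊖ n ⟧ ≈ m ×ᵣ 1# - n ×ᵣ 1#
  ⊖-homo zero zero = sym (-‿inverseʳ 0#)
  ⊖-homo zero (suc n) = sym (+-identityˡ _)
  ⊖-homo (suc m) zero = sym (trans (+-congˡ -0#≈0#) (+-identityʳ _))
  ⊖-homo (suc m) (suc n) = begin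
    ⟦ suc m ℤ.⊖ suc n ⟧               ≡⟨ ≡.cong ⟦_⟧ (ℤₚ.[1+m]⊖[1+n]≡m⊖n m n) ⟩
    ⟦ m ℤ.⊖ n ⟧                       ≈⟨ ⊖-homo m n ⟩
    m ×ᵣ 1# - n ×ᵣ 1#                   ≈⟨ +-identityˡ _ ⟨
    0# + (m ×ᵣ 1# - n ×ᵣ 1#)            ≈⟨ +-congʳ (-‿inverseʳ 1#) ⟨
    1# - 1# + (m ×ᵣ 1# - n ×ᵣ 1#)       ≈⟨ interchange _ _ _ _ ⟩
    1# + m ×ᵣ 1# + (- 1# - n ×ᵣ 1#)     ≈⟨ +-congˡ (-‿+-comm 1# _) ⟩
    1# + m ×ᵣ 1# - (1# + n ×ᵣ 1#)       ≈⟨ +-cong (1+× m 1#) (-‿cong (1+× n 1#)) ⟨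
    suc m ×ᵣ 1# - suc n ×ᵣ 1#           ∎

  +-homo : ∀ i j → ⟦ i ℤ.+ j ⟧ ≈ ⟦ i ⟧ + ⟦ j ⟧
  +-homo (+ m) (+ n) = ×-homo-+ 1# m n
  +-homo (+ m) -[1+ n ] = ⊖-homo m (suc n)
  +-homo -[1+ m ] (+ n) = trans (⊖-homo n (suc m)) (+-comm _ _)
  +-homo -[1+ m ] -[1+ n ] = begin
    - (suc (suc (m ℕ.+ n)) ×ᵣ 1#)      ≡⟨ ≡.cong (λ k → - (k ×ᵣ 1#)) (≡.cong suc (ℕₚ.+-suc m n)) ⟨
    - ((suc m ℕ.+ suc n) ×ᵣ 1#)        ≈⟨ -‿cong (×-homo-+ 1# (suc m) (suc n)) ⟩
    - (suc m ×ᵣ 1# + suc n ×ᵣ 1#)       ≈⟨ -‿+-comm _ _ ⟨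
    - (suc m ×ᵣ 1#) - suc n ×ᵣ 1#       ∎

  -‿homo : ∀ i → ⟦ ℤ.- i ⟧ ≈ - ⟦ i ⟧
  -‿homo (+ zero) = sym -0#≈0#
  -‿homo +[1+ n ] = refl
  -‿homo -[1+ n ] = sym (-‿involutive _)

  *-homo-+ : ∀ m j → ⟦ + m ℤ.* j ⟧ ≈ m ×ᵣ 1# * ⟦ j ⟧
  *-homo-+ zero j = trans (reflexive (≡.cong ⟦_⟧ (ℤₚ.*-zeroˡ j))) (sym (zeroˡ _))
  *-homo-+ (suc m) j = begin
    ⟦ + suc m ℤ.* j ⟧               ≡⟨ ≡.cong ⟦_⟧ (ℤₚ.suc-* (+ m) j) ⟩
    ⟦ j ℤ.+ + m ℤ.* j ⟧             ≈⟨ +-homo j (+ m ℤ.* j) ⟩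
    ⟦ j ⟧ + ⟦ + m ℤ.* j ⟧           ≈⟨ +-cong (sym (*-identityˡ _)) (*-homo-+ m j) ⟩
    1# * ⟦ j ⟧ + m ×ᵣ 1# * ⟦ j ⟧     ≈⟨ distribʳ _ _ _ ⟨
    (1# + m ×ᵣ 1#) * ⟦ j ⟧           ≈⟨ *-congʳ (1+× m 1#) ⟨
    suc m ×ᵣ 1# * ⟦ j ⟧              ∎

  *-homo : ∀ i j → ⟦ i ℤ.* j ⟧ ≈ ⟦ i ⟧ * ⟦ j ⟧
  *-homo (+ m) j = *-homo-+ m j
  *-homo -[1+ m ] j = begin
    ⟦ -[1+ m ] ℤ.* j ⟧              ≡⟨ ≡.cong ⟦_⟧ (ℤₚ.neg-distribˡ-* +[1+ m ] j) ⟨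
    ⟦ ℤ.- (+[1+ m ] ℤ.* j) ⟧        ≈⟨ -‿homo (+[1+ m ] ℤ.* j) ⟩
    - ⟦ +[1+ m ] ℤ.* j ⟧            ≈⟨ -‿cong (*-homo-+ (suc m) j) ⟩
    - (suc m ×ᵣ 1# * ⟦ j ⟧)          ≈⟨ -‿distribˡ-* _ _ ⟩
    - (suc m ×ᵣ 1#) * ⟦ j ⟧          ∎

  -- The solver has to recognise equal coefficients in order to cancel terms. Equality in ℤ is
  -- decidable, whereas the abstract ring `R` brings no such test.
  morphism : CommutativeRing.rawRing ℤₚ.+-*-commutativeRing -Raw-AlmostCommutative⟶ fromCommutativeRing R
  morphism = record
    { ⟦_⟧ = ⟦_⟧ ; +-homo = +-homo ; *-homo = *-homo ; -‿homo = -‿homo ; 0-homo = refl ; 1-homo = refl }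

  open RingSolver (CommutativeRing.rawRing ℤₚ.+-*-commutativeRing) (fromCommutativeRing R) morphism
    (λ i j → Maybe.map (λ i≡j → reflexive (≡.cong ⟦_⟧ i≡j)) (dec⇒maybe (i ℤ.≟ j)))
    public using (solve; con; _:=_; _:+_; _:*_; _:-_)

-- Descents of inversion sequences

-- The newest entry comes first, so a descent is an entry followed in the list by a larger one.
infixr 5 _∷_
data Inversions : ℕ → Set where
  []  : Inversions 0
  _∷_ : ∀ {n} → Fin (suc n) → Inversions n → Inversions (suc n)

newest : ∀ {n} → Inversions (suc n) → ℕ
newest (q ∷ _) = toℕ q

descent : ℕ → ℕ → ℕ
descent _       zero    = 0
descent zero    (suc _) = 1
descent (suc a) (suc b) = descent a b

descents : ∀ {n} → Inversions n → ℕ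
descents [] = 0
descents (q ∷ []) = 0
descents (q ∷ es@(q′ ∷ _)) = descent (toℕ q) (toℕ q′) ℕ.+ descents es

-- The older entries form the outer index, so a sum over sequences splits into inner sums over the
-- newest entry with the rest held fixed.
allInversions : ∀ n → List (Inversions n)
allInversions zero = [] ∷ []
allInversions (suc n) = cartesianProductWith (flip _∷_) (allInversions n) (allFin (suc n))

-- Descent polynomials and the kernel method

module DescentSeries {c ℓ} (R : CommutativeRing c ℓ) where

  open CommutativeRing R hiding (zero)
  open SetoidReasoning setoid
  open IntegerCoefficients R using (solve; con; _:=_; _:+_; _:*_; _:-_)
  open Exp semiring using (_^_; ^-congˡ; ^-homo-*)
  open CommutativeExp commutativeSemiring using (^-distrib-*)
  open Sum semiring using (sum; sum-cong-≋; *-distribˡ-sum)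

  ∑ : ∀ {A : Set} → List A → (A → Carrier) → Carrier
  ∑ [] f = 0#
  ∑ (x ∷ xs) f = f x + ∑ xs f

  ∑-cong : ∀ {A : Set} (xs : List A) {f g : A → Carrier} → (∀ x → f x ≈ g x) → ∑ xs f ≈ ∑ xs g
  ∑-cong [] f≈g = refl
  ∑-cong (x ∷ xs) f≈g = +-cong (f≈g x) (∑-cong xs f≈g)

  ∑-distribˡ : ∀ {A : Set} (xs : List A) a {f : A → Carrier} → a * ∑ xs f ≈ ∑ xs (λ x → a * f x)
  ∑-distribˡ [] a = zeroʳ a
  ∑-distribˡ (x ∷ xs) a = trans (distribˡ a _ _) (+-congˡ (∑-distribˡ xs a))

  ∑-++ : ∀ {A : Set} (xs ys : List A) (f : A → Carrier) → ∑ (xs ++ ys) f ≈ ∑ xs f + ∑ ys f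
  ∑-++ [] ys f = sym (+-identityˡ _)
  ∑-++ (x ∷ xs) ys f = trans (+-congˡ (∑-++ xs ys f)) (sym (+-assoc _ _ _))

  ∑-map : ∀ {A B : Set} (g : A → B) xs (f : B → Carrier) → ∑ (map g xs) f ≡ ∑ xs (f ∘ g)
  ∑-map g [] f = ≡.refl
  ∑-map g (x ∷ xs) f = ≡.cong (λ s → f (g x) + s) (∑-map g xs f)

  ∑-tabulate : ∀ {A : Set} {n} (g : Fin n → A) (f : A → Carrier) → ∑ (tabulate g) f ≡ sum (f ∘ g)
  ∑-tabulate {n = zero} g f = ≡.refl
  ∑-tabulate {n = suc n} g f = ≡.cong (λ s → f (g Fin.zero) + s) (∑-tabulate (g ∘ Fin.suc) f)

  ∑-cartesianProductWith : ∀ {A B C : Set} (h : A → B → C) xs ys (f : C → Carrier) →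
    ∑ (cartesianProductWith h xs ys) f ≈ ∑ xs (λ x → ∑ ys (λ y → f (h x y)))
  ∑-cartesianProductWith h [] ys f = refl
  ∑-cartesianProductWith h (x ∷ xs) ys f =
    trans (∑-++ (map (h x) ys) _ f) (+-cong (reflexive (∑-map (h x) ys f)) (∑-cartesianProductWith h xs ys f))

  *-one-^ : ∀ a b k → a * (b * 1# ^ k) ≈ b * a
  *-one-^ a b zero = solve 2 (λ a b → a :* (b :* con (+ 1)) := b :* a) refl a b
  *-one-^ a b (suc k) = trans (*-congˡ (*-congˡ (*-identityˡ _))) (*-one-^ a b k)

  module _ (z w : Carrier) where

    v : Carrier
    v = 1# - w

    geometric : ∀ x k → (1# - x) * sum {k} (λ q → x ^ toℕ q) ≈ 1# - x ^ k
    geometric x zero = solve 1 (λ x → (con (+ 1) :- x) :* con (+ 0) := con (+ 1) :- con (+ 1)) refl x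
    geometric x (suc k) = begin
      (1# - x) * (1# + sum {k} (λ q → x * x ^ toℕ q))
        ≈⟨ *-congˡ (+-congˡ (*-distribˡ-sum {k} x (λ q → x ^ toℕ q))) ⟨
      (1# - x) * (1# + x * s)
        ≈⟨ solve 2 (λ x s → (con (+ 1) :- x) :* (con (+ 1) :+ x :* s) := con (+ 1) :- x :+ x :* ((con (+ 1) :- x) :* s)) refl x s ⟩
      1# - x + x * ((1# - x) * s)
        ≈⟨ +-congˡ (*-congˡ (geometric x k)) ⟩
      1# - x + x * (1# - x ^ k)
        ≈⟨ solve 2 (λ x y → con (+ 1) :- x :+ x :* (con (+ 1) :- y) := con (+ 1) :- x :* y) refl x (x ^ k) ⟩
      1# - x * x ^ k ∎
      where s = sum {k} (λ q → x ^ toℕ q)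

    -- The entries q < b carry the weight w and the others the weight 1, so two geometric sums give
    -- w (1 - x^b) + (x^b - x^k).
    descent-geometric : ∀ x {k} {b} → b ℕ.≤ k →
      (1# - x) * sum {k} (λ q → x ^ toℕ q * w ^ descent (toℕ q) b) ≈ w + v * x ^ b - x ^ k
    descent-geometric x {k} ℕ.z≤n = begin
      (1# - x) * sum {k} (λ q → x ^ toℕ q * 1#) ≈⟨ *-congˡ (sum-cong-≋ {k} (λ q → *-identityʳ (x ^ toℕ q))) ⟩
      (1# - x) * sum {k} (λ q → x ^ toℕ q)      ≈⟨ geometric x k ⟩
      1# - x ^ k ≈⟨ solve 2 (λ w y → con (+ 1) :- y := w :+ (con (+ 1) :- w) :* con (+ 1) :- y) refl w (x ^ k) ⟩
      w + v * 1# - x ^ k ∎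
    descent-geometric x {suc k} {suc b} (ℕ.s≤s b≤k) = begin
      (1# - x) * (1# * (w * 1#) + sum {k} (λ q → x * x ^ toℕ q * w ^ descent (toℕ q) b))
        ≈⟨ *-congˡ (+-congˡ (trans (sum-cong-≋ {k} (λ q → *-assoc _ _ _)) (sym (*-distribˡ-sum {k} x (λ q → x ^ toℕ q * w ^ descent (toℕ q) b))))) ⟩
      (1# - x) * (1# * (w * 1#) + x * s)
        ≈⟨ solve 3 (λ x w s → (con (+ 1) :- x) :* (con (+ 1) :* (w :* con (+ 1)) :+ x :* s) := w :- x :* w :+ x :* ((con (+ 1) :- x) :* s)) refl x w s ⟩
      w - x * w + x * ((1# - x) * s)
        ≈⟨ +-congˡ (*-congˡ (descent-geometric x b≤k)) ⟩
      w - x * w + x * (w + v * x ^ b - x ^ k)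
        ≈⟨ solve 5 (λ x w v y y′ → w :- x :* w :+ x :* (w :+ v :* y :- y′) := w :+ v :* (x :* y) :- x :* y′) refl x w v (x ^ b) (x ^ k) ⟩
      w + v * (x * x ^ b) - x * x ^ k ∎
      where s = sum {k} (λ q → x ^ toℕ q * w ^ descent (toℕ q) b)

    descentGF : ℕ → Carrier
    descentGF n = ∑ (allInversions n) (λ es → w ^ descents es)

    -- Index n stands for length n + 1, because the empty sequence has no newest entry.
    newestGF : ℕ → Carrier → Carrier
    newestGF n x = ∑ (allInversions (suc n)) (λ es → x ^ newest es * w ^ descents es)

    -- A new entry ranges over n + 2 values: `descent-geometric` applies with `k = n + 2` and `b`
    -- the previous newest entry.
    newestGF-suc : ∀ n x →
      (1# - x) * newestGF (suc n) x ≈ w * descentGF (suc n) + v * newestGF n x - x ^ suc (suc n) * descentGF (suc n)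
    newestGF-suc n x = begin
      (1# - x) * newestGF (suc n) x
        ≈⟨ *-congˡ (∑-cartesianProductWith (flip _∷_) (allInversions (suc n)) (allFin (suc (suc n))) _) ⟩
      (1# - x) * ∑ (allInversions (suc n)) (λ es → ∑ (allFin (suc (suc n))) (λ q → x ^ toℕ q * w ^ descents (q ∷ es)))
        ≈⟨ ∑-distribˡ (allInversions (suc n)) _ ⟩
      ∑ (allInversions (suc n)) (λ es → (1# - x) * ∑ (allFin (suc (suc n))) (λ q → x ^ toℕ q * w ^ descents (q ∷ es)))
        ≈⟨ ∑-cong (allInversions (suc n)) insert ⟩
      ∑ (allInversions (suc n)) (λ es → w * w ^ descents es + v * (x ^ newest es * w ^ descents es) - x ^ suc (suc n) * w ^ descents es)
        ≈⟨ split (allInversions (suc n)) ⟩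
      w * descentGF (suc n) + v * newestGF n x - x ^ suc (suc n) * descentGF (suc n) ∎
      where
      insert : ∀ es → (1# - x) * ∑ (allFin (suc (suc n))) (λ q → x ^ toℕ q * w ^ descents (q ∷ es))
        ≈ w * w ^ descents es + v * (x ^ newest es * w ^ descents es) - x ^ suc (suc n) * w ^ descents es
      insert es@(q′ ∷ _) = begin
        (1# - x) * ∑ (allFin (suc (suc n))) (λ q → x ^ toℕ q * w ^ descents (q ∷ es))
          ≡⟨ ≡.cong ((1# - x) *_) (∑-tabulate {n = suc (suc n)} id (λ q → x ^ toℕ q * w ^ descents (q ∷ es))) ⟩
        (1# - x) * sum {suc (suc n)} (λ q → x ^ toℕ q * w ^ descents (q ∷ es))
          ≈⟨ *-congˡ (sum-cong-≋ {suc (suc n)} (λ q → trans (*-congˡ (^-homo-* w (descent (toℕ q) (toℕ q′)) (descents es)))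
               (solve 3 (λ a b c → a :* (b :* c) := c :* (a :* b)) refl (x ^ toℕ q) _ (w ^ descents es)))) ⟩
        (1# - x) * sum {suc (suc n)} (λ q → w ^ descents es * (x ^ toℕ q * w ^ descent (toℕ q) (toℕ q′)))
          ≈⟨ *-congˡ (*-distribˡ-sum {suc (suc n)} (w ^ descents es) (λ q → x ^ toℕ q * w ^ descent (toℕ q) (toℕ q′))) ⟨
        (1# - x) * (w ^ descents es * sum {suc (suc n)} (λ q → x ^ toℕ q * w ^ descent (toℕ q) (toℕ q′)))
          ≈⟨ solve 3 (λ a b c → a :* (b :* c) := b :* (a :* c)) refl _ _ _ ⟩
        w ^ descents es * ((1# - x) * sum {suc (suc n)} (λ q → x ^ toℕ q * w ^ descent (toℕ q) (toℕ q′)))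
          ≈⟨ *-congˡ (descent-geometric x (ℕₚ.≤-trans (ℕₚ.<⇒≤ (Finₚ.toℕ<n q′)) (ℕₚ.n≤1+n _))) ⟩
        w ^ descents es * (w + v * x ^ toℕ q′ - x ^ suc (suc n))
          ≈⟨ solve 5 (λ d w v a b → d :* (w :+ v :* a :- b) := w :* d :+ v :* (a :* d) :- b :* d) refl (w ^ descents es) w v (x ^ toℕ q′) (x ^ suc (suc n)) ⟩
        w * w ^ descents es + v * (x ^ newest es * w ^ descents es) - x ^ suc (suc n) * w ^ descents es ∎
      split : ∀ ess → ∑ ess (λ es → w * w ^ descents es + v * (x ^ newest es * w ^ descents es) - x ^ suc (suc n) * w ^ descents es)
        ≈ w * ∑ ess (λ es → w ^ descents es) + v * ∑ ess (λ es → x ^ newest es * w ^ descents es) - x ^ suc (suc n) * ∑ ess (λ es → w ^ descents es)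
      split [] = solve 3 (λ a b c → con (+ 0) := a :* con (+ 0) :+ b :* con (+ 0) :- c :* con (+ 0)) refl _ _ _
      split (es ∷ ess) = trans (+-congˡ (split ess))
        (solve 7 (λ w v y d r D R → (w :* d :+ v :* r :- y :* d) :+ (w :* D :+ v :* R :- y :* D) := w :* (d :+ D) :+ v :* (r :+ R) :- y :* (d :+ D))
          refl w v (x ^ suc (suc n)) (w ^ descents es) (x ^ newest es * w ^ descents es) _ _)

    -- Σ_{n<m} Tₙ zⁿ Xⁿ⁺¹: the factor X makes the functional equation below homogeneous.
    Ψ : ℕ → Carrier → Carrier
    Ψ zero X = 0#
    Ψ (suc m) X = Ψ m X + descentGF m * (z ^ m * X ^ suc m)

    Ψ-cong : ∀ m {X Y} → X ≈ Y → Ψ m X ≈ Ψ m Y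
    Ψ-cong zero X≈Y = refl
    Ψ-cong (suc m) X≈Y = +-cong (Ψ-cong m X≈Y) (*-congˡ (*-congˡ (^-congˡ (suc m) X≈Y)))

    module _ (X : Carrier) where

      -- The kernel: 1 − x = z(1−w)X, so that newestGF-suc telescopes after scaling by zⁿXⁿ⁺¹.
      x : Carrier
      x = 1# - z * v * X

      1-x : ∀ a → z * v * X * a ≈ (1# - x) * a
      1-x a = solve 2 (λ y a → y :* a := (con (+ 1) :- (con (+ 1) :- y)) :* a) refl (z * v * X) a

      -- The end of the telescoping sum, which the next summand would absorb.
      remainder : ℕ → Carrier
      remainder m = v * (X ^ suc (suc m) * newestGF m x)

      -- Multiply `newestGF-suc` by z^(m+1) X^(m+2). Since 1 - x = zvX, its left side becomes the
      -- remainder of index m + 1 with its power of z, and the term with `newestGF m` becomes that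
      -- of index m. What is left are the new summands of w Ψ(X) and of Ψ(Xx).
      Ψ-functional : ∀ m → Ψ (suc m) (X * x) + z ^ suc m * remainder m ≈ w * Ψ (suc m) X + v * X
      -- `descentGF 0` and `newestGF 0 x` each have one summand, equal to 1, and both sides expand
      -- to X.
      Ψ-functional zero = solve 3 (λ z w X → let o = con (+ 1); v = o :- w; x = o :- z :* v :* X in
        (con (+ 0) :+ (o :+ con (+ 0)) :* (o :* (X :* x :* o))) :+ z :* o :* (v :* (X :* (X :* o) :* (o :* o :+ con (+ 0))))
          := w :* (con (+ 0) :+ (o :+ con (+ 0)) :* (o :* (X :* o))) :+ v :* X) refl z w X
      Ψ-functional (suc m) = begin
        Ψ (suc m) (X * x) + D * (z ^ suc m * (X * x) ^ suc (suc m)) + z ^ suc (suc m) * remainder (suc m)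
          ≈⟨ +-congʳ (+-congˡ (*-congˡ (*-congˡ (^-distrib-* X x (suc (suc m)))))) ⟩
        Ψ (suc m) (X * x) + D * (z ^ suc m * (X ^ suc (suc m) * x ^ suc (suc m))) + z ^ suc (suc m) * remainder (suc m)
          ≈⟨ solve 8 (λ Ψ D zm Xm xm z v XR → Ψ :+ D :* (zm :* (Xm :* xm)) :+ z :* zm :* (v :* XR)
               := Ψ :+ zm :* Xm :* (D :* xm) :+ zm :* (z :* v :* XR)) refl
               (Ψ (suc m) (X * x)) D (z ^ suc m) (X ^ suc (suc m)) (x ^ suc (suc m)) z v (X ^ suc (suc (suc m)) * newestGF (suc m) x) ⟩
        Ψ (suc m) (X * x) + z ^ suc m * X ^ suc (suc m) * (D * x ^ suc (suc m)) + z ^ suc m * (z * v * (X * X ^ suc (suc m) * newestGF (suc m) x))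
          ≈⟨ solve 7 (λ a zm Xm b z v R → let X = a in b :+ zm :* (z :* v :* (X :* Xm :* R)) := b :+ zm :* Xm :* (z :* v :* X :* R)) refl
               X (z ^ suc m) (X ^ suc (suc m)) _ z v (newestGF (suc m) x) ⟩
        Ψ (suc m) (X * x) + z ^ suc m * X ^ suc (suc m) * (D * x ^ suc (suc m)) + z ^ suc m * X ^ suc (suc m) * (z * v * X * newestGF (suc m) x)
          ≈⟨ +-congˡ (*-congˡ (trans (1-x _) (newestGF-suc m x))) ⟩
        Ψ (suc m) (X * x) + z ^ suc m * X ^ suc (suc m) * (D * x ^ suc (suc m)) + z ^ suc m * X ^ suc (suc m) * (w * D + v * newestGF m x - x ^ suc (suc m) * D)
          ≈⟨ solve 8 (λ Ψ zm Xm D xm w v R → Ψ :+ zm :* Xm :* (D :* xm) :+ zm :* Xm :* (w :* D :+ v :* R :- xm :* D)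
                := Ψ :+ zm :* (v :* (Xm :* R)) :+ w :* (D :* (zm :* Xm))) refl
               (Ψ (suc m) (X * x)) (z ^ suc m) (X ^ suc (suc m)) D (x ^ suc (suc m)) w v (newestGF m x) ⟩
        Ψ (suc m) (X * x) + z ^ suc m * remainder m + w * (D * (z ^ suc m * X ^ suc (suc m)))
          ≈⟨ +-congʳ (Ψ-functional m) ⟩
        w * Ψ (suc m) X + v * X + w * (D * (z ^ suc m * X ^ suc (suc m)))
          ≈⟨ solve 4 (λ w a b c → w :* a :+ b :+ w :* c := w :* (a :+ c) :+ b) refl w _ _ _ ⟩
        w * Ψ (suc (suc m)) X + v * X ∎
        where D = descentGF (suc m)

    module _ (r p : ℕ → Carrier) (p-zero : p 0 ≈ 1#) (p-suc : ∀ j → p (suc j) ≈ p j * r j)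
             (r-quadratic : ∀ j → r j ≈ 1# + z * v * p j * (r j * r j)) where

      partialSum : ℕ → Carrier
      partialSum zero = 0#
      partialSum (suc J) = partialSum J + (r J - 1#) * w ^ J * p J

      -- The iteration produces weighted increments of the products; these are the required
      -- summands.
      summand : ∀ j → w ^ j * (p (suc j) - p j) ≈ (r j - 1#) * w ^ j * p j
      summand j = begin
        w ^ j * (p (suc j) - p j)    ≈⟨ *-congˡ (+-congʳ (p-suc j)) ⟩
        w ^ j * (p j * r j - p j)    ≈⟨ solve 3 (λ r a p → a :* (p :* r :- p) := (r :- con (+ 1)) :* a :* p) refl (r j) (w ^ j) (p j) ⟩
        (r j - 1#) * w ^ j * p j     ∎

      p-step : ∀ j → p (suc j) - p j ≈ z * v * (p (suc j) * p (suc j))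
      p-step j = begin
        p (suc j) - p j                                    ≈⟨ +-congʳ (p-suc j) ⟩
        p j * r j - p j                                    ≈⟨ +-congʳ (*-congˡ (r-quadratic j)) ⟩
        p j * (1# + z * v * p j * (r j * r j)) - p j
          ≈⟨ solve 3 (λ y p r → p :* (con (+ 1) :+ y :* p :* (r :* r)) :- p := y :* (p :* r :* (p :* r))) refl (z * v) (p j) (r j) ⟩
        z * v * (p j * r j * (p j * r j))                  ≈⟨ *-congˡ (*-cong (p-suc j) (p-suc j)) ⟨
        z * v * (p (suc j) * p (suc j))                    ∎

      -- Each step trades Ψ - id at `p J` for w times Ψ - id at `p (suc J)` plus one increment. The
      -- errors are gathered in an unspecified `u`, as only the power of z in front of it matters.
      Ψ-iterated : ∀ m J → ∃ λ u →
        Ψ (suc m) 1# ≈ 1# + partialSum J + w ^ J * (Ψ (suc m) (p J) - p J) + z ^ suc m * u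
      Ψ-iterated m zero = 0# , (begin
        Ψ (suc m) 1# ≈⟨ solve 2 (λ a zm → a := con (+ 1) :+ con (+ 0) :+ con (+ 1) :* (a :- con (+ 1)) :+ zm :* con (+ 0)) refl _ (z ^ suc m) ⟩
        1# + 0# + 1# * (Ψ (suc m) 1# - 1#) + z ^ suc m * 0#
          ≈⟨ +-congʳ (+-congˡ (*-congˡ (+-cong (Ψ-cong (suc m) p-zero) (-‿cong p-zero)))) ⟨
        1# + 0# + 1# * (Ψ (suc m) (p 0) - p 0) + z ^ suc m * 0# ∎)
      Ψ-iterated m (suc J) with Ψ-iterated m J
      -- The remainder is added inside the bracket to complete the left side of `Ψ-functional`, and
      -- is taken out again here.
      ... | u , eq = u - w ^ J * remainder q m , (begin
        Ψ (suc m) 1# ≈⟨ eq ⟩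
        1# + partialSum J + w ^ J * (Ψ (suc m) (p J) - p J) + z ^ suc m * u
          ≈⟨ solve 7 (λ S wJ a b zm u r → con (+ 1) :+ S :+ wJ :* (a :- b) :+ zm :* u := con (+ 1) :+ S :+ wJ :* (a :+ zm :* r :- b) :+ zm :* (u :- wJ :* r)) refl
               (partialSum J) (w ^ J) _ (p J) (z ^ suc m) u (remainder q m) ⟩
        1# + partialSum J + w ^ J * (Ψ (suc m) (p J) + z ^ suc m * remainder q m - p J) + z ^ suc m * (u - w ^ J * remainder q m)
          ≈⟨ +-congʳ (+-congˡ (*-congˡ (+-congʳ (trans (+-congʳ (Ψ-cong (suc m) pJ≈)) (Ψ-functional q m))))) ⟩
        1# + partialSum J + w ^ J * (w * Ψ (suc m) q + v * q - p J) + z ^ suc m * (u - w ^ J * remainder q m)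
          ≈⟨ solve 7 (λ S wJ a w q b c → con (+ 1) :+ S :+ wJ :* (w :* a :+ (con (+ 1) :- w) :* q :- b) :+ c := con (+ 1) :+ (S :+ wJ :* (q :- b)) :+ w :* wJ :* (a :- q) :+ c) refl
               (partialSum J) (w ^ J) _ w q (p J) _ ⟩
        1# + (partialSum J + w ^ J * (q - p J)) + w ^ suc J * (Ψ (suc m) q - q) + z ^ suc m * (u - w ^ J * remainder q m)
          ≈⟨ +-congʳ (+-congʳ (+-congˡ (+-congˡ (summand J)))) ⟩
        1# + partialSum (suc J) + w ^ suc J * (Ψ (suc m) q - q) + z ^ suc m * (u - w ^ J * remainder q m) ∎)
        where
        q = p (suc J)
        pJ≈ : p J ≈ q * x q
        pJ≈ = begin
          p J                      ≈⟨ solve 2 (λ a b → a := b :- (b :- a)) refl (p J) q ⟩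
          q - (q - p J)            ≈⟨ +-congˡ (-‿cong (p-step J)) ⟩
          q - z * v * (q * q)      ≈⟨ solve 2 (λ y q → q :- y :* (q :* q) := q :* (con (+ 1) :- y :* q)) refl (z * v) q ⟩
          q * x q                  ∎

open ≡ using (_≢_; refl; sym; trans; cong; cong₂; subst; subst₂; ≢-sym; setoid; module ≡-Reasoning)
open ≡-Reasoning

-- Series is ℤ[[w]][[z]].
module W = PowerSeries ℤₚ.+-*-commutativeRing
module Z = PowerSeries W.commutativeRing

-- Catalan numbers

absorption : ∀ n k → suc k ℕ.* (suc n C suc k) ≡ suc n ℕ.* (n C k)
absorption n zero = begin
  1 ℕ.* (suc n C 1)   ≡⟨ ℕₚ.*-identityˡ _ ⟩
  suc n C 1           ≡⟨ nC1≡n (suc n) ⟩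
  suc n               ≡⟨ ℕₚ.*-identityʳ _ ⟨
  suc n ℕ.* 1         ∎
absorption zero (suc k) = begin
  suc (suc k) ℕ.* (1 C suc (suc k)) ≡⟨ cong (suc (suc k) ℕ.*_) (k>n⇒nCk≡0 {1} {suc (suc k)} (ℕ.s≤s (ℕ.s≤s ℕ.z≤n))) ⟩
  suc (suc k) ℕ.* 0                 ≡⟨ ℕₚ.*-zeroʳ (suc (suc k)) ⟩
  0                                 ≡⟨ cong (1 ℕ.*_) (k>n⇒nCk≡0 {0} {suc k} (ℕ.s≤s ℕ.z≤n)) ⟨
  1 ℕ.* (0 C suc k)                 ∎
absorption (suc n) (suc k) = begin
  suc (suc k) ℕ.* (suc (suc n) C suc (suc k))
    ≡⟨ cong (suc (suc k) ℕ.*_) (nCk+nC[k+1]≡[n+1]C[k+1] (suc n) (suc k)) ⟨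
  suc (suc k) ℕ.* (a ℕ.+ b)
    ≡⟨ expand (suc k) a b ⟩
  a ℕ.+ (suc k ℕ.* a ℕ.+ suc (suc k) ℕ.* b)
    ≡⟨ cong (a ℕ.+_) (cong₂ ℕ._+_ (absorption n k) (absorption n (suc k))) ⟩
  a ℕ.+ (suc n ℕ.* (n C k) ℕ.+ suc n ℕ.* (n C suc k))
    ≡⟨ cong (a ℕ.+_) (ℕₚ.*-distribˡ-+ (suc n) (n C k) (n C suc k)) ⟨
  a ℕ.+ suc n ℕ.* (n C k ℕ.+ n C suc k)
    ≡⟨ cong (λ c → a ℕ.+ suc n ℕ.* c) (nCk+nC[k+1]≡[n+1]C[k+1] n k) ⟩
  suc (suc n) ℕ.* a ∎
  where
  a = suc n C suc k
  b = suc n C suc (suc k)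
  expand : ∀ k a b → suc k ℕ.* (a ℕ.+ b) ≡ a ℕ.+ (k ℕ.* a ℕ.+ suc k ℕ.* b)
  expand = ℕSolver.solve-∀

central : ℕ → ℕ
central k = (2 ℕ.* k) C k

-- The division in `catalan` is exact because C(2k, k) = (k + 1) (C(2k, k) - C(2k, k + 1)), used
-- here in a form without subtraction.
suc-∣-central : ∀ k → suc k ∣ central k
suc-∣-central k = ∣m+n∣m⇒∣n (subst (suc k ∣_) eq (m∣m*n (central k))) (m∣m*n ((2 ℕ.* k) C suc k))
  where
  eq : suc k ℕ.* central k ≡ suc k ℕ.* ((2 ℕ.* k) C suc k) ℕ.+ central k
  -- Adding k C(2k, k) turns the left side into (2k + 1) C(2k, k), to which absorption applies.
  eq = ℕₚ.+-cancelˡ-≡ (k ℕ.* central k) _ _ (begin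
    k ℕ.* central k ℕ.+ suc k ℕ.* central k
      ≡⟨ lem k (central k) ⟩
    suc (2 ℕ.* k) ℕ.* central k
      ≡⟨ absorption (2 ℕ.* k) k ⟨
    suc k ℕ.* (suc (2 ℕ.* k) C suc k)
      ≡⟨ cong (suc k ℕ.*_) (nCk+nC[k+1]≡[n+1]C[k+1] (2 ℕ.* k) k) ⟨
    suc k ℕ.* (central k ℕ.+ (2 ℕ.* k) C suc k)
      ≡⟨ lem₂ k (central k) _ ⟩
    k ℕ.* central k ℕ.+ (suc k ℕ.* ((2 ℕ.* k) C suc k) ℕ.+ central k) ∎)
    where
    lem : ∀ k a → k ℕ.* a ℕ.+ suc k ℕ.* a ≡ suc (2 ℕ.* k) ℕ.* a
    lem = ℕSolver.solve-∀
    lem₂ : ∀ k a b → suc k ℕ.* (a ℕ.+ b) ≡ k ℕ.* a ℕ.+ (suc k ℕ.* b ℕ.+ a)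
    lem₂ = ℕSolver.solve-∀

suc*catalan : ∀ k → suc k ℕ.* catalan k ≡ central k
suc*catalan k = m*[n/m]≡n (suc-∣-central k)

-- Absorption is used twice; in between, the symmetry of row 2k + 1 exchanges C(2k + 1, k) for C(2k
-- + 1, k + 1).
central-suc : ∀ k → suc k ℕ.* central (suc k) ≡ 2 ℕ.* (suc (2 ℕ.* k) ℕ.* central k)
central-suc k = begin
  suc k ℕ.* ((2 ℕ.* suc k) C suc k)       ≡⟨ cong (λ m → suc k ℕ.* (m C suc k)) (2*suc k) ⟩
  suc k ℕ.* (suc (suc (2 ℕ.* k)) C suc k) ≡⟨ absorption (suc (2 ℕ.* k)) k ⟩
  suc (suc (2 ℕ.* k)) ℕ.* (suc (2 ℕ.* k) C k)
    ≡⟨ cong₂ ℕ._*_ (sym (2*suc k)) (nCk≡nC[n∸k] (ℕₚ.m≤n⇒m≤1+n (ℕₚ.m≤m+n k _))) ⟩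
  2 ℕ.* suc k ℕ.* (suc (2 ℕ.* k) C (suc (2 ℕ.* k) ∸ k))
    ≡⟨ cong (λ m → 2 ℕ.* suc k ℕ.* (suc (2 ℕ.* k) C m)) complement ⟩
  2 ℕ.* suc k ℕ.* (suc (2 ℕ.* k) C suc k)
    ≡⟨ ℕₚ.*-assoc 2 (suc k) _ ⟩
  2 ℕ.* (suc k ℕ.* (suc (2 ℕ.* k) C suc k))
    ≡⟨ cong (2 ℕ.*_) (absorption (2 ℕ.* k) k) ⟩
  2 ℕ.* (suc (2 ℕ.* k) ℕ.* central k) ∎
  where
  2*suc : ∀ k → 2 ℕ.* suc k ≡ suc (suc (2 ℕ.* k))
  2*suc = ℕSolver.solve-∀
  complement : suc (2 ℕ.* k) ∸ k ≡ suc k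
  complement = trans (cong (_∸ k) (shuffle k)) (ℕₚ.m+n∸m≡n k (suc k))
    where
    shuffle : ∀ k → suc (2 ℕ.* k) ≡ k ℕ.+ suc k
    shuffle = ℕSolver.solve-∀

catalan-suc : ∀ k → suc (suc k) ℕ.* catalan (suc k) ≡ (4 ℕ.* k ℕ.+ 2) ℕ.* catalan k
catalan-suc k = ℕₚ.*-cancelˡ-≡ _ _ (suc k) (begin
  suc k ℕ.* (suc (suc k) ℕ.* catalan (suc k)) ≡⟨ cong (suc k ℕ.*_) (suc*catalan (suc k)) ⟩
  suc k ℕ.* central (suc k)                   ≡⟨ central-suc k ⟩
  2 ℕ.* (suc (2 ℕ.* k) ℕ.* central k)         ≡⟨ cong (λ c → 2 ℕ.* (suc (2 ℕ.* k) ℕ.* c)) (suc*catalan k) ⟨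
  2 ℕ.* (suc (2 ℕ.* k) ℕ.* (suc k ℕ.* catalan k)) ≡⟨ shuffle k (catalan k) ⟩
  suc k ℕ.* ((4 ℕ.* k ℕ.+ 2) ℕ.* catalan k)   ∎)
  where
  shuffle : ∀ k c → 2 ℕ.* (suc (2 ℕ.* k) ℕ.* (suc k ℕ.* c)) ≡ suc k ℕ.* ((4 ℕ.* k ℕ.+ 2) ℕ.* c)
  shuffle = ℕSolver.solve-∀

cat : ℕ → ℤ
cat k = + catalan k

module _ where
  open W

  -- The Euler operator x d/dx on coefficient sequences.
  θ : (ℕ → ℤ) → ℕ → ℤ
  θ f n = + n ℤ.* f n

  -- The Leibniz rule. Dropping the constant term does not commute with `θ`; `θ-suc` supplies the
  -- correction `f′`.
  θ-⊛ : ∀ f g n → θ (f ⊛ g) n ≡ (θ f ⊛ g) n ℤ.+ (f ⊛ θ g) n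
  θ-⊛ f g zero = lem (f 0) (g 0)
    where
    lem : ∀ a b → + 0 ℤ.* (a ℤ.* b) ≡ + 0 ℤ.* a ℤ.* b ℤ.+ a ℤ.* (+ 0 ℤ.* b)
    lem = ℤSolver.solve-∀
  θ-⊛ f g (suc n) = begin
    + suc n ℤ.* (f 0 ℤ.* g (suc n) ℤ.+ (f′ ⊛ g) n)
      ≡⟨ cong (ℤ._* (f 0 ℤ.* g (suc n) ℤ.+ (f′ ⊛ g) n)) (ℤₚ.pos-+ 1 n) ⟩
    (+ 1 ℤ.+ + n) ℤ.* (f 0 ℤ.* g (suc n) ℤ.+ (f′ ⊛ g) n)
      ≡⟨ lem (+ n) (f 0) (g (suc n)) _ ⟩
    θ f 0 ℤ.* g (suc n) ℤ.+ (θ (f′ ⊛ g) n ℤ.+ (f′ ⊛ g) n) ℤ.+ f 0 ℤ.* ((+ 1 ℤ.+ + n) ℤ.* g (suc n))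
      ≡⟨ cong₂ (λ a b → θ f 0 ℤ.* g (suc n) ℤ.+ (a ℤ.+ (f′ ⊛ g) n) ℤ.+ f 0 ℤ.* (b ℤ.* g (suc n))) (θ-⊛ f′ g n) (sym (ℤₚ.pos-+ 1 n)) ⟩
    θ f 0 ℤ.* g (suc n) ℤ.+ ((θ f′ ⊛ g) n ℤ.+ (f′ ⊛ θ g) n ℤ.+ (f′ ⊛ g) n) ℤ.+ f 0 ℤ.* θ g (suc n)
      ≡⟨ lem₂ (θ f 0 ℤ.* g (suc n)) ((θ f′ ⊛ g) n) _ _ _ ⟩
    θ f 0 ℤ.* g (suc n) ℤ.+ ((θ f′ ⊛ g) n ℤ.+ (f′ ⊛ g) n) ℤ.+ (f 0 ℤ.* θ g (suc n) ℤ.+ (f′ ⊛ θ g) n)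
      ≡⟨ cong (λ a → θ f 0 ℤ.* g (suc n) ℤ.+ a ℤ.+ (f 0 ℤ.* θ g (suc n) ℤ.+ (f′ ⊛ θ g) n)) (⊛-distribʳ g (θ f′) f′ n) ⟨
    θ f 0 ℤ.* g (suc n) ℤ.+ ((λ k → θ f′ k ℤ.+ f′ k) ⊛ g) n ℤ.+ (f 0 ℤ.* θ g (suc n) ℤ.+ (f′ ⊛ θ g) n)
      ≡⟨ cong (λ a → θ f 0 ℤ.* g (suc n) ℤ.+ a ℤ.+ (f 0 ℤ.* θ g (suc n) ℤ.+ (f′ ⊛ θ g) n)) (⊛-cong {g = g} θ-suc (λ _ → refl) n) ⟨
    (θ f ⊛ g) (suc n) ℤ.+ (f ⊛ θ g) (suc n) ∎
    where
    f′ = f ∘ suc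
    lem : ∀ n a b c → (+ 1 ℤ.+ n) ℤ.* (a ℤ.* b ℤ.+ c) ≡ + 0 ℤ.* a ℤ.* b ℤ.+ (n ℤ.* c ℤ.+ c) ℤ.+ a ℤ.* ((+ 1 ℤ.+ n) ℤ.* b)
    lem = ℤSolver.solve-∀
    lem₂ : ∀ a b c d e → a ℤ.+ (b ℤ.+ c ℤ.+ d) ℤ.+ e ≡ a ℤ.+ (b ℤ.+ d) ℤ.+ (e ℤ.+ c)
    lem₂ = ℤSolver.solve-∀
    θ-suc : ∀ k → θ f (suc k) ≡ θ f′ k ℤ.+ f′ k
    θ-suc k = trans (cong (ℤ._* f′ k) (ℤₚ.pos-+ 1 k)) (lem₃ (+ k) (f′ k))
      where
      lem₃ : ∀ k a → (+ 1 ℤ.+ k) ℤ.* a ≡ k ℤ.* a ℤ.+ a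
      lem₃ = ℤSolver.solve-∀

  cat-step : ∀ k → (+ 2 ℤ.+ + k) ℤ.* cat (suc k) ≡ (+ 4 ℤ.* + k ℤ.+ + 2) ℤ.* cat k
  cat-step k = begin
    (+ 2 ℤ.+ + k) ℤ.* cat (suc k)              ≡⟨ ℤₚ.pos-* (suc (suc k)) (catalan (suc k)) ⟨
    + (suc (suc k) ℕ.* catalan (suc k))        ≡⟨ cong +_ (catalan-suc k) ⟩
    + ((4 ℕ.* k ℕ.+ 2) ℕ.* catalan k)          ≡⟨ ℤₚ.pos-* (4 ℕ.* k ℕ.+ 2) (catalan k) ⟩
    + (4 ℕ.* k ℕ.+ 2) ℤ.* cat k                ≡⟨ cong (λ a → (a ℤ.+ + 2) ℤ.* cat k) (ℤₚ.pos-* 4 k) ⟩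
    (+ 4 ℤ.* + k ℤ.+ + 2) ℤ.* cat k            ∎

  -- Exchanging the two equal factors replaces the weight i by its average n/2.
  2*θcat⊛cat : ∀ n → + 2 ℤ.* (θ cat ⊛ cat) n ≡ + n ℤ.* (cat ⊛ cat) n
  2*θcat⊛cat n = begin
    + 2 ℤ.* (θ cat ⊛ cat) n                 ≡⟨ double ((θ cat ⊛ cat) n) ⟩
    (θ cat ⊛ cat) n ℤ.+ (θ cat ⊛ cat) n     ≡⟨ cong (λ a → (θ cat ⊛ cat) n ℤ.+ a) (⊛-comm (θ cat) cat n) ⟩
    (θ cat ⊛ cat) n ℤ.+ (cat ⊛ θ cat) n     ≡⟨ θ-⊛ cat cat n ⟨
    + n ℤ.* (cat ⊛ cat) n                   ∎
    where
    double : ∀ a → + 2 ℤ.* a ≡ a ℤ.+ a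
    double = ℤSolver.solve-∀

  -- The weighted sum Σ (i+1) cᵢ cₙ₋ᵢ is evaluated twice: by symmetry it is (n+2)/2 · Σ cᵢ cₙ₋ᵢ,
  -- and by the two-term recurrence for cᵢ it reduces to the convolution for n−1.
  catalan-convolution : ∀ n → cat (suc n) ≡ (cat ⊛ cat) n
  catalan-convolution zero = refl
  catalan-convolution (suc m) = sym (ℤₚ.*-cancelˡ-≡ (+ suc (suc (suc m))) _ _ (begin
    (+ 3 ℤ.+ + m) ℤ.* S                        ≡⟨ e₁ (+ m) S ⟩
    (+ 1 ℤ.+ + m) ℤ.* S ℤ.+ + 2 ℤ.* S          ≡⟨ cong (ℤ._+ + 2 ℤ.* S) (2*θcat⊛cat (suc m)) ⟨
    + 2 ℤ.* (θ cat ⊛ cat) (suc m) ℤ.+ + 2 ℤ.* S ≡⟨ e₂ ((θ cat ⊛ cat) (suc m)) S ⟩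
    + 2 ℤ.* ((θ cat ⊛ cat) (suc m) ℤ.+ S)      ≡⟨ cong (+ 2 ℤ.*_) (⊛-distribʳ cat (θ cat) cat (suc m)) ⟨
    + 2 ℤ.* (+ 1 ℤ.* cat (suc m) ℤ.+ ((λ k → θ cat (suc k) ℤ.+ cat (suc k)) ⊛ cat) m)
      ≡⟨ cong (λ a → + 2 ℤ.* (+ 1 ℤ.* cat (suc m) ℤ.+ a)) (⊛-cong {g = cat} step (λ _ → refl) m) ⟩
    + 2 ℤ.* (+ 1 ℤ.* cat (suc m) ℤ.+ ((λ k → + 4 ℤ.* θ cat k ℤ.+ + 2 ℤ.* cat k) ⊛ cat) m)
      ≡⟨ cong (λ a → + 2 ℤ.* (+ 1 ℤ.* cat (suc m) ℤ.+ a)) (trans (⊛-distribʳ cat (λ k → + 4 ℤ.* θ cat k) _ m) (cong₂ ℤ._+_ (scale-⊛ (+ 4) (θ cat) cat m) (scale-⊛ (+ 2) cat cat m))) ⟩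
    + 2 ℤ.* (+ 1 ℤ.* cat (suc m) ℤ.+ (+ 4 ℤ.* (θ cat ⊛ cat) m ℤ.+ + 2 ℤ.* (cat ⊛ cat) m))
      ≡⟨ e₃ (cat (suc m)) ((θ cat ⊛ cat) m) _ ⟩
    + 2 ℤ.* (cat (suc m) ℤ.+ + 2 ℤ.* (+ 2 ℤ.* (θ cat ⊛ cat) m) ℤ.+ + 2 ℤ.* (cat ⊛ cat) m)
      ≡⟨ cong (λ a → + 2 ℤ.* (cat (suc m) ℤ.+ + 2 ℤ.* a ℤ.+ + 2 ℤ.* (cat ⊛ cat) m)) (2*θcat⊛cat m) ⟩
    + 2 ℤ.* (cat (suc m) ℤ.+ + 2 ℤ.* (+ m ℤ.* (cat ⊛ cat) m) ℤ.+ + 2 ℤ.* (cat ⊛ cat) m)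
      ≡⟨ cong (λ a → + 2 ℤ.* (cat (suc m) ℤ.+ + 2 ℤ.* (+ m ℤ.* a) ℤ.+ + 2 ℤ.* a)) (catalan-convolution m) ⟨
    + 2 ℤ.* (cat (suc m) ℤ.+ + 2 ℤ.* (+ m ℤ.* cat (suc m)) ℤ.+ + 2 ℤ.* cat (suc m))
      ≡⟨ e₄ (+ m) (cat (suc m)) ⟩
    (+ 4 ℤ.* (+ 1 ℤ.+ + m) ℤ.+ + 2) ℤ.* cat (suc m)
      ≡⟨ cat-step (suc m) ⟨
    (+ 3 ℤ.+ + m) ℤ.* cat (suc (suc m)) ∎))
    where
    S = (cat ⊛ cat) (suc m)
    e₁ : ∀ m s → (+ 3 ℤ.+ m) ℤ.* s ≡ (+ 1 ℤ.+ m) ℤ.* s ℤ.+ + 2 ℤ.* s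
    e₁ = ℤSolver.solve-∀
    e₂ : ∀ a b → + 2 ℤ.* a ℤ.+ + 2 ℤ.* b ≡ + 2 ℤ.* (a ℤ.+ b)
    e₂ = ℤSolver.solve-∀
    e₃ : ∀ a b c → + 2 ℤ.* (+ 1 ℤ.* a ℤ.+ (+ 4 ℤ.* b ℤ.+ + 2 ℤ.* c)) ≡ + 2 ℤ.* (a ℤ.+ + 2 ℤ.* (+ 2 ℤ.* b) ℤ.+ + 2 ℤ.* c)
    e₃ = ℤSolver.solve-∀
    e₄ : ∀ m a → + 2 ℤ.* (a ℤ.+ + 2 ℤ.* (m ℤ.* a) ℤ.+ + 2 ℤ.* a) ≡ (+ 4 ℤ.* (+ 1 ℤ.+ m) ℤ.+ + 2) ℤ.* a
    e₄ = ℤSolver.solve-∀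
    step : ∀ k → θ cat (suc k) ℤ.+ cat (suc k) ≡ + 4 ℤ.* θ cat k ℤ.+ + 2 ℤ.* cat k
    step k = begin
      (+ 1 ℤ.+ + k) ℤ.* cat (suc k) ℤ.+ cat (suc k) ≡⟨ s₁ (+ k) (cat (suc k)) ⟩
      (+ 2 ℤ.+ + k) ℤ.* cat (suc k)                 ≡⟨ cat-step k ⟩
      (+ 4 ℤ.* + k ℤ.+ + 2) ℤ.* cat k               ≡⟨ s₂ (+ k) (cat k) ⟩
      + 4 ℤ.* θ cat k ℤ.+ + 2 ℤ.* cat k             ∎
      where
      s₁ : ∀ k a → (+ 1 ℤ.+ k) ℤ.* a ℤ.+ a ≡ (+ 2 ℤ.+ k) ℤ.* a
      s₁ = ℤSolver.solve-∀
      s₂ : ∀ k a → (+ 4 ℤ.* k ℤ.+ + 2) ℤ.* a ≡ + 4 ℤ.* (k ℤ.* a) ℤ.+ + 2 ℤ.* a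
      s₂ = ℤSolver.solve-∀

-- The tier counts descents

-- The distinguished `x` lies after or before the cut between `as` and `bs`. In `passesFuel-build`
-- the cut is the place of m and `x` is m + 1.
++-∷-split : ∀ {A : Set} (as bs as′ : List A) {x bs′} → as ++ bs ≡ as′ ++ x ∷ bs′ →
  (∃ λ us → as′ ≡ as ++ us × bs ≡ us ++ x ∷ bs′) ⊎ (∃ λ us → as ≡ as′ ++ x ∷ us × bs′ ≡ us ++ bs)
++-∷-split [] bs as′ eq = inj₁ (as′ , refl , eq)
++-∷-split (a ∷ as) bs [] refl = inj₂ (as , refl , refl)
++-∷-split (a ∷ as) bs (a′ ∷ as′) eq with refl , eq′ ← Listₚ.∷-injective eq with ++-∷-split as bs as′ eq′
... | inj₁ (us , refl , q) = inj₁ (us , refl , q)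
... | inj₂ (us , refl , q) = inj₂ (us , refl , q)

++-∷-unique : ∀ {A : Set} {x : A} as as′ {bs bs′} → All (_≢ x) as → All (_≢ x) as′ →
  as ++ x ∷ bs ≡ as′ ++ x ∷ bs′ → as ≡ as′ × bs ≡ bs′
++-∷-unique [] [] _ _ refl = refl , refl
++-∷-unique [] (_ ∷ _) _ (a≢x ∷ _) refl = contradiction refl a≢x
++-∷-unique (_ ∷ _) [] (a≢x ∷ _) _ refl = contradiction refl a≢x
++-∷-unique (a ∷ as) (_ ∷ as′) (_ ∷ p) (_ ∷ p′) eq with refl , eq′ ← Listₚ.∷-injective eq
  with refl , refl ← ++-∷-unique as as′ p p′ eq′ = refl , refl

take-length-++ : ∀ {A : Set} (as bs : List A) → take (length as) (as ++ bs) ≡ as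
take-length-++ [] bs = refl
take-length-++ (a ∷ as) bs = cong (a ∷_) (take-length-++ as bs)

drop-length-++ : ∀ {A : Set} (as bs : List A) → drop (length as) (as ++ bs) ≡ bs
drop-length-++ [] bs = refl
drop-length-++ (a ∷ as) bs = drop-length-++ as bs

Unique-resp-↭ : ∀ {xs ys : List ℕ} → xs ↭ ys → Unique xs → Unique ys
Unique-resp-↭ p = SetoidPermutation.Unique-resp-↭ (setoid ℕ) (↭⇒↭ₛ p)

descent-< : ∀ {a b} → a < b → descent a b ≡ 1
descent-< {zero} {suc b} _ = refl
descent-< {suc a} {suc b} (s≤s a<b) = descent-< a<b

descent-≥ : ∀ {a b} → b ≤ a → descent a b ≡ 0
descent-≥ z≤n = refl
descent-≥ (s≤s b≤a) = descent-≥ b≤a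

-- The permutation of m, …, m+n−1 in which, for each value inserted from the largest down,
-- the corresponding entry counts the larger values to its right.
build : ∀ {n} → ℕ → Inversions n → List ℕ
build m [] = []
build {suc n} m (q ∷ es) = take (n ∸ toℕ q) (build (suc m) es) ++ m ∷ drop (n ∸ toℕ q) (build (suc m) es)

build-↭ : ∀ {n} m (q : Fin (suc n)) es → build m (q ∷ es) ↭ m ∷ build (suc m) es
build-↭ {n} m q es = ↭-trans (shift m (take k ys) (drop k ys)) (↭-prep m (↭-reflexive (Listₚ.take++drop≡id k ys)))
  where
  k = n ∸ toℕ q
  ys = build (suc m) es

build-length : ∀ {n} m (es : Inversions n) → length (build m es) ≡ n
build-length m [] = refl
build-length m (q ∷ es) = trans (↭-length (build-↭ m q es)) (cong suc (build-length (suc m) es))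

build-≥ : ∀ {n} m (es : Inversions n) → All (m ≤_) (build m es)
build-≥ m [] = []
build-≥ m (q ∷ es) = All-resp-↭ (↭-sym (build-↭ m q es)) (ℕₚ.≤-refl ∷ All.map ℕₚ.<⇒≤ (build-≥ (suc m) es))

build-< : ∀ {n} m (es : Inversions n) → All (_< m ℕ.+ n) (build m es)
build-< m [] = []
build-< {suc n} m (q ∷ es) = All-resp-↭ (↭-sym (build-↭ m q es))
  (ℕₚ.m<m+n m (s≤s z≤n) ∷ subst (λ k → All (_< k) (build (suc m) es)) (sym (ℕₚ.+-suc m n)) (build-< (suc m) es))

build-unique : ∀ {n} m (es : Inversions n) → Unique (build m es)
build-unique m [] = []
build-unique m (q ∷ es) = Unique-resp-↭ (↭-sym (build-↭ m q es))
  (All.map ℕₚ.<⇒≢ (build-≥ (suc m) es) ∷ build-unique (suc m) es)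

-- Replaces the `take` and `drop` of `build` by named factors, on which the case analysis of a pass
-- can match; `q` becomes the number of entries to the right of m.
record Insertion (m q : ℕ) (ys xs : List ℕ) : Set where
  constructor insertion
  field
    {left right} : List ℕ
    whole : xs ≡ left ++ m ∷ right
    removed : ys ≡ left ++ right
    position : length right ≡ q
    left-≢ : All (_≢ m) left
    right-≢ : All (_≢ m) right

build-insertion : ∀ {n} m (q : Fin (suc n)) es → Insertion m (toℕ q) (build (suc m) es) (build m (q ∷ es))
build-insertion {n} m q es = insertion refl (sym split) position (Allₚ.++⁻ˡ (take k ys) ≢m) (Allₚ.++⁻ʳ (take k ys) ≢m)
  where
  k = n ∸ toℕ q
  ys = build (suc m) es
  split = Listₚ.take++drop≡id k ys
  ≢m : All (_≢ m) (take k ys ++ drop k ys)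
  ≢m = subst (All (_≢ m)) (sym split) (All.map (≢-sym ∘ ℕₚ.<⇒≢) (build-≥ (suc m) es))
  position : length (drop k ys) ≡ toℕ q
  position = begin
    length (drop k ys) ≡⟨ Listₚ.length-drop k ys ⟩
    length ys ∸ k      ≡⟨ cong (_∸ k) (build-length (suc m) es) ⟩
    n ∸ (n ∸ toℕ q)    ≡⟨ ℕₚ.m∸[m∸n]≡n (ℕₚ.≤-pred (Finₚ.toℕ<n q)) ⟩
    toℕ q              ∎

-- Bijection between inversion sequences and permutations

build-injective : ∀ {n} m {es es′ : Inversions n} → build m es ≡ build m es′ → es ≡ es′
build-injective m {[]} {[]} eq = refl
build-injective m {q ∷ es} {q′ ∷ es′} eq with build-insertion m q es | build-insertion m q′ es′
... | insertion {l} w r p l≢ _ | insertion {l′} w′ r′ p′ l′≢ _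
  with refl , refl ← ++-∷-unique l l′ l≢ l′≢ (trans (sym w) (trans eq w′))
  = cong₂ _∷_ (Finₚ.toℕ-injective (trans (sym p) p′)) (build-injective (suc m) (trans r (sym r′)))

InRange : ℕ → ℕ → ℕ → Set
InRange m n x = m ≤ x × x < m ℕ.+ n

InRange-suc : ∀ {m n x} → x ≢ m → InRange m (suc n) x → InRange (suc m) n x
InRange-suc {m} {n} {x} x≢m (m≤x , x<) = ℕₚ.≤∧≢⇒< m≤x (≢-sym x≢m) , subst (x <_) (ℕₚ.+-suc m n) x<

remove-min : ∀ {m n} as {bs} → Unique (as ++ m ∷ bs) → All (InRange m (suc n)) (as ++ m ∷ bs) →
  Unique (as ++ bs) × All (InRange (suc m) n) (as ++ bs)
remove-min {m} as {bs} u r with Unique-resp-↭ (shift m as bs) u | All-resp-↭ (shift m as bs) r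
... | m∉ ∷ u′ | _ ∷ r′ = u′ , All.zipWith (λ (m≢x , x-in) → InRange-suc (≢-sym m≢x) x-in) (m∉ , r′)

avoid-min : ∀ {m n xs} → m ∉ xs → All (InRange m (suc n)) xs → All (InRange (suc m) n) xs
avoid-min m∉ r = All.zipWith (λ (x≢m , x-in) → InRange-suc x≢m x-in) (All.map ≢-sym (Allₚ.¬Any⇒All¬ _ m∉) , r)

length-++-∷ : ∀ {A : Set} (as : List A) {x bs} → length (as ++ x ∷ bs) ≡ suc (length (as ++ bs))
length-++-∷ [] = refl
length-++-∷ (a ∷ as) = cong suc (length-++-∷ as)

-- Guarantees that the minimum m occurs: n + 1 distinct entries avoiding m would have to fit into n
-- values.
pigeonhole : ∀ m n {xs} → Unique xs → All (InRange m n) xs → length xs ≤ n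
pigeonhole m zero {[]} _ _ = z≤n
pigeonhole m zero {x ∷ xs} _ ((m≤x , x<m) ∷ _) = contradiction (subst (x <_) (ℕₚ.+-identityʳ m) x<m) (ℕₚ.≤⇒≯ m≤x)
pigeonhole m (suc n) {xs} u r with m ∈? xs
... | no m∉ = ℕₚ.m≤n⇒m≤1+n (pigeonhole (suc m) n u (avoid-min m∉ r))
... | yes m∈ with as , bs , refl ← ∈-∃++ m∈ with u′ , r′ ← remove-min as u r
  = subst (_≤ suc n) (sym (length-++-∷ as)) (s≤s (pigeonhole (suc m) n u′ r′))

-- The inverse construction deletes the minimum m and records the number of entries to its right.
build-surjective : ∀ n m {xs} → length xs ≡ n → Unique xs → All (InRange m n) xs →
  ∃ λ (es : Inversions n) → xs ≡ build m es
build-surjective zero m {[]} _ _ _ = [] , refl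
build-surjective (suc n) m {xs} len u r with m ∈? xs
... | no m∉ = contradiction (subst (_≤ n) len (pigeonhole (suc m) n u (avoid-min m∉ r))) (ℕₚ.<-irrefl refl)
... | yes m∈ with as , bs , refl ← ∈-∃++ m∈
  with u′ , r′ ← remove-min as u r
  with len′ ← ℕₚ.suc-injective (trans (sym (length-++-∷ as)) len)
  with es , eq ← build-surjective n (suc m) len′ u′ r′
  = fromℕ< bs< ∷ es , cong₂ (λ l r → l ++ m ∷ r)
      (trans (sym (take-length-++ as bs)) (cong₂ take k≡ eq))
      (trans (sym (drop-length-++ as bs)) (cong₂ drop k≡ eq))
  where
  len-++ : length as ℕ.+ length bs ≡ n
  len-++ = trans (sym (Listₚ.length-++ as)) len′
  bs< : length bs < suc n
  bs< = s≤s (subst (length bs ≤_) len-++ (ℕₚ.m≤n+m _ (length as)))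
  k≡ : length as ≡ n ∸ toℕ (fromℕ< bs<)
  k≡ = begin
    length as                            ≡⟨ ℕₚ.m+n∸n≡m (length as) (length bs) ⟨
    length as ℕ.+ length bs ∸ length bs    ≡⟨ cong₂ _∸_ len-++ (sym (Finₚ.toℕ-fromℕ< bs<)) ⟩
    n ∸ toℕ (fromℕ< bs<)                 ∎

words-suc : ∀ len n → words (suc len) n ≡ cartesianProductWith _∷_ (map suc (upTo n)) (words len n)
words-suc len n = go (map suc (upTo n))
  where
  go : ∀ xs → concatMap (λ x → map (x ∷_) (words len n)) xs ≡ cartesianProductWith _∷_ xs (words len n)
  go [] = refl
  go (x ∷ xs) = cong (map (x ∷_) (words len n) ++_) (go xs)

words-unique : ∀ len n → Unique (words len n)
words-unique zero n = [] ∷ []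
words-unique (suc len) n = subst Unique (sym (words-suc len n))
  (Uniqueₚ.cartesianProductWith⁺ _∷_ Listₚ.∷-injective (Uniqueₚ.map⁺ ℕₚ.suc-injective (Uniqueₚ.upTo⁺ n)) (words-unique len n))

∈-words⁺ : ∀ {len n xs} → length xs ≡ len → All (InRange 1 n) xs → xs ∈ words len n
∈-words⁺ {xs = []} refl [] = here refl
∈-words⁺ {n = n} {xs = suc x ∷ xs} refl ((_ , s≤s x<n) ∷ r) = subst (_ ∈_) (sym (words-suc (length xs) n))
  (∈-cartesianProductWith⁺ _∷_ (∈-map⁺ suc (∈-upTo⁺ x<n)) (∈-words⁺ refl r))

∈-words⁻ : ∀ len {n xs} → xs ∈ words len n → length xs ≡ len × All (InRange 1 n) xs
∈-words⁻ zero (here refl) = refl , []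
∈-words⁻ (suc len) {n} xs∈
  with x , ys , x∈ , ys∈ , refl ← ∈-cartesianProductWith⁻ _∷_ (map suc (upTo n)) (words len n) (subst (_ ∈_) (words-suc len n) xs∈)
  with y , y∈ , refl ← ∈-map⁻ suc x∈
  with refl , r ← ∈-words⁻ len ys∈
  = refl , (s≤s z≤n , s≤s (∈-upTo⁻ y∈)) ∷ r

∈-allInversions : ∀ {n} (es : Inversions n) → es ∈ allInversions n
∈-allInversions [] = here refl
∈-allInversions (q ∷ es) = ∈-cartesianProductWith⁺ (flip _∷_) (∈-allInversions es) (∈-allFin q)

allInversions-unique : ∀ n → Unique (allInversions n)
allInversions-unique zero = [] ∷ []
allInversions-unique (suc n) =
  Uniqueₚ.cartesianProductWith⁺ (flip _∷_) (λ { refl → refl , refl }) (allInversions-unique n) (Uniqueₚ.allFin⁺ (suc n))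

-- Both lists are free of repetitions and have the same members. Their order may differ, which a
-- count does not see.
perms-↭ : ∀ n → perms n ↭ map (build 1) (allInversions n)
perms-↭ n = ∼bag⇒↭ (unique∧set⇒bag
  (Uniqueₚ.filter⁺ unique? (words-unique n n))
  (Uniqueₚ.map⁺ (build-injective 1) (allInversions-unique n))
  (mk⇔ to from))
  where
  to : ∀ {π} → π ∈ perms n → π ∈ map (build 1) (allInversions n)
  to π∈ with π∈w , u ← ∈-filter⁻ unique? π∈ with len , r ← ∈-words⁻ n π∈w
    with es , refl ← build-surjective n 1 len u r = ∈-map⁺ (build 1) (∈-allInversions es)
  from : ∀ {π} → π ∈ map (build 1) (allInversions n) → π ∈ perms n
  from π∈ with es , _ , refl ← ∈-map⁻ (build 1) π∈ =
    ∈-filter⁺ unique? (∈-words⁺ (build-length 1 es) (All.zip (build-≥ 1 es , build-< 1 es))) (build-unique 1 es)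

-- The course of a pass

≡ᵇ-refl : ∀ m → (m ≡ᵇ m) ≡ true
≡ᵇ-refl zero = refl
≡ᵇ-refl (suc m) = ≡ᵇ-refl m

≡ᵇ-≢ : ∀ {x m} → x ≢ m → (x ≡ᵇ m) ≡ false
≡ᵇ-≢ {zero} {zero} x≢m = contradiction refl x≢m
≡ᵇ-≢ {zero} {suc m} _ = refl
≡ᵇ-≢ {suc x} {zero} _ = refl
≡ᵇ-≢ {suc x} {suc m} x≢m = ≡ᵇ-≢ (x≢m ∘ cong suc)

popAll-≡ : ∀ m s → popAll m (m ∷ s) ≡ popAll (suc m) s
popAll-≡ m s = cong (if_then popAll (suc m) s else (m , m ∷ s)) (≡ᵇ-refl m)

popAll-≢ : ∀ {m x} s → x ≢ m → popAll m (x ∷ s) ≡ (m , x ∷ s)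
popAll-≢ {m} {x} s x≢m = cong (if_then popAll (suc m) s else (m , x ∷ s)) (≡ᵇ-≢ x≢m)

-- The top of this stack is the last entry of `u ∷ us`; the induction reaches it by moving heads
-- onto `s`.
popAll-blocked : ∀ {m} u us s → All (_≢ m) (u ∷ us) → popAll m ((u ∷ us) ʳ++ s) ≡ (m , (u ∷ us) ʳ++ s)
popAll-blocked u [] s (u≢m ∷ []) = popAll-≢ s u≢m
popAll-blocked u (u′ ∷ us) s (_ ∷ us≢m) = popAll-blocked u′ us (u ∷ s) us≢m

popAll-avoids : ∀ {m} as → All (_≢ m) as → popAll m (reverse as) ≡ (m , reverse as)
popAll-avoids [] _ = refl
popAll-avoids (a ∷ as) as≢m = popAll-blocked a as [] as≢m

-- Names the continuation hidden in the `with` of `passFrom`, so that equations for `popAll` can be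
-- used under `cong`. `continue` does the same for `passesFuel`.
resume : List ℕ → ℕ × List ℕ → ℕ × List ℕ
resume xs (m , s) = passFrom m s xs

passFrom-∷ : ∀ m s x xs → passFrom m s (x ∷ xs) ≡ resume xs (popAll m (x ∷ s))
passFrom-∷ m s x xs with popAll m (x ∷ s)
... | _ , _ = refl

passFrom-push : ∀ {m} s as bs → All (_≢ m) as → passFrom m s (as ++ bs) ≡ passFrom m (as ʳ++ s) bs
passFrom-push s [] bs _ = refl
passFrom-push {m} s (a ∷ as) bs (a≢m ∷ as≢m) = begin
  passFrom m s (a ∷ as ++ bs)               ≡⟨ passFrom-∷ m s a (as ++ bs) ⟩
  resume (as ++ bs) (popAll m (a ∷ s))      ≡⟨ cong (resume (as ++ bs)) (popAll-≢ s a≢m) ⟩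
  passFrom m (a ∷ s) (as ++ bs)             ≡⟨ passFrom-push (a ∷ s) as bs as≢m ⟩
  passFrom m (as ʳ++ a ∷ s) bs              ∎

-- Until m arrives entries are only pushed, and m is popped at once. What happens next depends on
-- whether m + 1 is then on top.
pass-to-min : ∀ m as bs → All (_≢ m) as → pass m (as ++ m ∷ bs) ≡ resume bs (popAll (suc m) (reverse as))
pass-to-min m as bs as≢m = begin
  pass m (as ++ m ∷ bs)                     ≡⟨ passFrom-push [] as (m ∷ bs) as≢m ⟩
  passFrom m (reverse as) (m ∷ bs)          ≡⟨ passFrom-∷ m (reverse as) m bs ⟩
  resume bs (popAll m (m ∷ reverse as))     ≡⟨ cong (resume bs) (popAll-≡ m (reverse as)) ⟩
  resume bs (popAll (suc m) (reverse as))   ∎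

-- Once m has left, the stack is the one that a pass for m + 1 on the list without m would have
-- built, so m costs no pass of its own.
pass-left : ∀ m as us bs → All (_≢ m) as → All (_≢ suc m) (as ++ us) →
  pass m (as ++ m ∷ us ++ suc m ∷ bs) ≡ pass (suc m) ((as ++ us) ++ suc m ∷ bs)
pass-left m as us bs as≢m as≢ = begin
  pass m (as ++ m ∷ rest)                      ≡⟨ pass-to-min m as rest as≢m ⟩
  resume rest (popAll (suc m) (reverse as))    ≡⟨ cong (resume rest) (popAll-avoids as (Allₚ.++⁻ˡ as as≢)) ⟩
  passFrom (suc m) (reverse as) rest           ≡⟨ passFrom-push [] as rest (Allₚ.++⁻ˡ as as≢) ⟨
  pass (suc m) (as ++ rest)                    ≡⟨ cong (pass (suc m)) (Listₚ.++-assoc as us (suc m ∷ bs)) ⟨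
  pass (suc m) ((as ++ us) ++ suc m ∷ bs)      ∎
  where rest = us ++ suc m ∷ bs

-- Popping m exposes m + 1, which leaves in the same pass, just as if m had been absent.
pass-adjacent : ∀ m as bs → All (_≢ m) (as ++ suc m ∷ []) → All (_≢ suc m) as →
  pass m ((as ++ suc m ∷ []) ++ m ∷ bs) ≡ pass (suc m) (as ++ suc m ∷ bs)
pass-adjacent m as bs ≢m as≢ = begin
  pass m ((as ++ suc m ∷ []) ++ m ∷ bs)                    ≡⟨ pass-to-min m (as ++ suc m ∷ []) bs ≢m ⟩
  resume bs (popAll (suc m) (reverse (as ++ suc m ∷ [])))  ≡⟨ cong (resume bs ∘ popAll (suc m)) (Listₚ.++-ʳ++ as) ⟩
  resume bs (popAll (suc m) (suc m ∷ reverse as))          ≡⟨ cong (resume bs) (popAll-≡ (suc m) (reverse as)) ⟩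
  resume bs (popAll (suc (suc m)) (reverse as))            ≡⟨ pass-to-min (suc m) as bs as≢ ⟨
  pass (suc m) (as ++ suc m ∷ bs)                          ∎

-- The next output m+1 is buried below u, so nothing more is popped in this pass.
pass-separated : ∀ m as u us bs → All (_≢ m) (as ++ suc m ∷ u ∷ us) → All (_≢ suc m) (u ∷ us ++ bs) →
  pass m ((as ++ suc m ∷ u ∷ us) ++ m ∷ bs) ≡ (suc m , as ++ suc m ∷ u ∷ us ++ bs)
pass-separated m as u us bs ≢m ≢ = begin
  pass m (l ++ m ∷ bs)                          ≡⟨ pass-to-min m l bs ≢m ⟩
  resume bs (popAll (suc m) (reverse l))        ≡⟨ cong (resume bs) blocked ⟩
  passFrom (suc m) (reverse l) bs               ≡⟨ cong (passFrom (suc m) (reverse l)) (Listₚ.++-identityʳ bs) ⟨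
  passFrom (suc m) (reverse l) (bs ++ [])       ≡⟨ passFrom-push (reverse l) bs [] (Allₚ.++⁻ʳ (u ∷ us) ≢) ⟩
  suc m , reverse (bs ʳ++ reverse l)            ≡⟨ cong (λ s → suc m , reverse s) (Listₚ.++-ʳ++ l) ⟨
  suc m , reverse (reverse (l ++ bs))           ≡⟨ cong (suc m ,_) (Listₚ.reverse-involutive (l ++ bs)) ⟩
  suc m , l ++ bs                               ≡⟨ cong (suc m ,_) (Listₚ.++-assoc as (suc m ∷ u ∷ us) bs) ⟩
  suc m , as ++ suc m ∷ u ∷ us ++ bs            ∎
  where
  l = as ++ suc m ∷ u ∷ us
  blocked : popAll (suc m) (reverse l) ≡ (suc m , reverse l)
  blocked = subst (λ s → popAll (suc m) s ≡ (suc m , s)) (sym (Listₚ.++-ʳ++ as))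
    (popAll-blocked u us (suc m ∷ reverse as) (Allₚ.++⁻ˡ (u ∷ us) ≢))

continue : ℕ → ℕ × List ℕ → ℕ
continue f (m , xs) = suc (passesFuel f m xs)

passesFuel-suc : ∀ f m as {x bs} → passesFuel (suc f) m (as ++ x ∷ bs) ≡ continue f (pass m (as ++ x ∷ bs))
passesFuel-suc f m [] {x} {bs} with pass m (x ∷ bs)
... | _ , _ = refl
passesFuel-suc f m (a ∷ as) {x} {bs} with pass m (a ∷ as ++ x ∷ bs)
... | _ , _ = refl

pass-single : ∀ m → pass m (m ∷ []) ≡ (suc m , [])
pass-single m = pass-to-min m [] [] []

-- The numbers q and q′ count the entries to the right of m and, with m removed, of m + 1. If m is
-- left of m + 1, then q > q′; if it follows immediately, q = q′; in both cases the pass goes on and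
-- the fuel stays. Only if something separates them is q < q′, and then one pass and one unit of
-- fuel are spent.
passesFuel-build : ∀ {n} f m (es : Inversions (suc n)) → suc n ≤ f → passesFuel f m (build m es) ≡ suc (descents es)
passesFuel-build (suc f) m (Fin.zero ∷ []) _ = trans (passesFuel-suc f m [] {m} {[]}) (cong (continue f) (pass-single m))
passesFuel-build (suc f) m es@(q ∷ es′@(q′ ∷ es″)) (s≤s n≤f)
  with build-insertion m q es′ | build-insertion (suc m) q′ es″
... | insertion {as} {bs} whole removed position as≢m bs≢m
    | insertion {as′} {bs′} whole′ removed′ position′ as′≢ bs′≢
  with ++-∷-split as bs as′ (trans (sym removed) whole′)
... | inj₁ (us , refl , refl) = begin
  passesFuel (suc f) m (build m es)                              ≡⟨ cong (passesFuel (suc f) m) whole ⟩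
  passesFuel (suc f) m (as ++ m ∷ us ++ suc m ∷ bs′)             ≡⟨ passesFuel-suc f m as ⟩
  continue f (pass m (as ++ m ∷ us ++ suc m ∷ bs′))              ≡⟨ cong (continue f) (pass-left m as us bs′ as≢m as′≢) ⟩
  continue f (pass (suc m) ((as ++ us) ++ suc m ∷ bs′))          ≡⟨ passesFuel-suc f (suc m) (as ++ us) ⟨
  passesFuel (suc f) (suc m) ((as ++ us) ++ suc m ∷ bs′)         ≡⟨ cong (passesFuel (suc f) (suc m)) whole′ ⟨
  passesFuel (suc f) (suc m) (build (suc m) es′)                 ≡⟨ passesFuel-build (suc f) (suc m) es′ (ℕₚ.m≤n⇒m≤1+n n≤f) ⟩
  suc (descents es′)                                             ≡⟨ cong (λ d → suc (d ℕ.+ descents es′)) (descent-≥ q′≤q) ⟨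
  suc (descents es)                                              ∎
  where
  q′≤q : toℕ q′ ≤ toℕ q
  q′≤q = subst₂ _≤_ position′ (trans (sym (Listₚ.length-++ us)) position)
    (ℕₚ.≤-trans (ℕₚ.n≤1+n (length bs′)) (ℕₚ.m≤n+m _ (length us)))
... | inj₂ ([] , refl , refl) = begin
  passesFuel (suc f) m (build m es)                              ≡⟨ cong (passesFuel (suc f) m) whole ⟩
  passesFuel (suc f) m ((as′ ++ suc m ∷ []) ++ m ∷ bs)           ≡⟨ passesFuel-suc f m (as′ ++ suc m ∷ []) ⟩
  continue f (pass m ((as′ ++ suc m ∷ []) ++ m ∷ bs))            ≡⟨ cong (continue f) (pass-adjacent m as′ bs as≢m as′≢) ⟩
  continue f (pass (suc m) (as′ ++ suc m ∷ bs))                  ≡⟨ passesFuel-suc f (suc m) as′ ⟨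
  passesFuel (suc f) (suc m) (as′ ++ suc m ∷ bs)                 ≡⟨ cong (passesFuel (suc f) (suc m)) whole′ ⟨
  passesFuel (suc f) (suc m) (build (suc m) es′)                 ≡⟨ passesFuel-build (suc f) (suc m) es′ (ℕₚ.m≤n⇒m≤1+n n≤f) ⟩
  suc (descents es′)                                             ≡⟨ cong (λ d → suc (d ℕ.+ descents es′)) (descent-≥ q′≤q) ⟨
  suc (descents es)                                              ∎
  where
  q′≤q : toℕ q′ ≤ toℕ q
  q′≤q = ℕₚ.≤-reflexive (trans (sym position′) position)
... | inj₂ (u ∷ us , refl , refl) = begin
  passesFuel (suc f) m (build m es)                              ≡⟨ cong (passesFuel (suc f) m) whole ⟩
  passesFuel (suc f) m (as ++ m ∷ bs)                            ≡⟨ passesFuel-suc f m as ⟩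
  continue f (pass m (as ++ m ∷ bs))                             ≡⟨ cong (continue f) (pass-separated m as′ u us bs as≢m bs′≢) ⟩
  suc (passesFuel f (suc m) (as′ ++ suc m ∷ u ∷ us ++ bs))       ≡⟨ cong (suc ∘ passesFuel f (suc m)) whole′ ⟨
  suc (passesFuel f (suc m) (build (suc m) es′))                 ≡⟨ cong suc (passesFuel-build f (suc m) es′ n≤f) ⟩
  suc (suc (descents es′))                                       ≡⟨ cong (λ d → suc (d ℕ.+ descents es′)) (descent-< q<q′) ⟨
  suc (descents es)                                              ∎
  where
  q<q′ : toℕ q < toℕ q′
  q<q′ = subst₂ _<_ position (trans (cong suc (sym (Listₚ.length-++ us))) position′) (s≤s (ℕₚ.m≤n+m _ (length us)))

tier-build : ∀ {n} (es : Inversions n) → tier (build 1 es) ≡ descents es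
tier-build [] = refl
tier-build es@(_ ∷ _) = cong (_∸ 1) (passesFuel-build _ 1 es (ℕₚ.≤-reflexive (sym (build-length 1 es))))

-- The ring of bivariate series

sumTo-cong : ∀ n {f g} → (∀ k → k ≤ n → f k ≡ g k) → sumTo n f ≡ sumTo n g
sumTo-cong zero eq = eq 0 z≤n
sumTo-cong (suc n) eq = cong₂ ℤ._+_ (sumTo-cong n (λ k k≤n → eq k (ℕₚ.m≤n⇒m≤1+n k≤n))) (eq (suc n) ℕₚ.≤-refl)

sumTo-head : ∀ n f → sumTo (suc n) f ≡ f 0 ℤ.+ sumTo n (f ∘ suc)
sumTo-head zero f = refl
sumTo-head (suc n) f = trans (cong (ℤ._+ f (suc (suc n))) (sumTo-head n f)) (ℤₚ.+-assoc (f 0) (sumTo n (f ∘ suc)) (f (suc (suc n))))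

sumTo-stable : ∀ {n N} f → n ≤ N → (∀ k → n < k → f k ≡ + 0) → sumTo N f ≡ sumTo n f
sumTo-stable {N = zero} f z≤n _ = refl
sumTo-stable {n} {suc N} f n≤ f≡0 with ℕₚ.m≤n⇒m<n∨m≡n n≤
... | inj₂ refl = refl
... | inj₁ (s≤s n≤N) = trans (cong₂ ℤ._+_ (sumTo-stable f n≤N f≡0) (f≡0 (suc N) (s≤s n≤N))) (ℤₚ.+-identityʳ _)

W-⊛-sumTo : ∀ f g t → (f W.⊛ g) t ≡ sumTo t (λ b → f b ℤ.* g (t ∸ b))
W-⊛-sumTo f g zero = refl
W-⊛-sumTo f g (suc t) = trans (cong (λ s → f 0 ℤ.* g (suc t) ℤ.+ s) (W-⊛-sumTo (f ∘ suc) g t)) (sym (sumTo-head t _))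

Z-⊛-sumTo : ∀ f g n t → (f Z.⊛ g) n t ≡ sumTo n (λ a → (f a W.⊛ g (n ∸ a)) t)
Z-⊛-sumTo f g zero t = refl
Z-⊛-sumTo f g (suc n) t = trans (cong (λ s → (f 0 W.⊛ g (suc n)) t ℤ.+ s) (Z-⊛-sumTo (f ∘ suc) g n t)) (sym (sumTo-head n _))

⊗≈⊛ : ∀ f g n t → (f ⊗ g) n t ≡ (f Z.⊛ g) n t
⊗≈⊛ f g n t = sym (trans (Z-⊛-sumTo f g n t) (sumTo-cong n (λ a _ → W-⊛-sumTo (f a) (g (n ∸ a)) t)))

𝟙≈one : ∀ n t → 𝟙 n t ≡ Z.one n t
𝟙≈one zero zero = refl
𝟙≈one zero (suc t) = refl
𝟙≈one (suc n) t = refl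

-- The operations are those of the statement, with laws transported along `⊗≈⊛`, so the results of
-- `DescentSeries` specialise to them directly.
seriesRing : CommutativeRing _ _
seriesRing = record
  { Carrier = Series
  ; _≈_ = λ f g → ∀ n t → f n t ≡ g n t
  ; _+_ = _⊕_
  ; _*_ = _⊗_
  ; -_ = λ f n t → ℤ.- f n t
  ; 0# = λ _ _ → + 0
  ; 1# = 𝟙
  ; isCommutativeRing = record
    { isRing = record
      { +-isAbelianGroup = R.+-isAbelianGroup
      ; *-cong = λ {f} {f′} {g} {g′} p q → R.trans {f ⊗ g} {f Z.⊛ g} {f′ ⊗ g′} (⊗≈⊛ f g)
          (R.trans {f Z.⊛ g} {f′ Z.⊛ g′} {f′ ⊗ g′} (R.*-cong {f} {f′} {g} {g′} p q) (R.sym {f′ ⊗ g′} {f′ Z.⊛ g′} (⊗≈⊛ f′ g′)))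
      ; *-assoc = λ f g h → R.trans {(f ⊗ g) ⊗ h} {(f Z.⊛ g) Z.⊛ h} {f ⊗ (g ⊗ h)} (⊗⊛ {f ⊗ g} {f Z.⊛ g} {h} {h} (⊗≈⊛ f g) (λ _ _ → refl))
          (R.trans {(f Z.⊛ g) Z.⊛ h} {f Z.⊛ (g Z.⊛ h)} {f ⊗ (g ⊗ h)} (R.*-assoc f g h)
            (R.sym {f ⊗ (g ⊗ h)} {f Z.⊛ (g Z.⊛ h)} (⊗⊛ {f} {f} {g ⊗ h} {g Z.⊛ h} (λ _ _ → refl) (⊗≈⊛ g h))))
      ; *-identity = (λ f → R.trans {𝟙 ⊗ f} {Z.one Z.⊛ f} {f} (⊗⊛ {𝟙} {Z.one} {f} {f} 𝟙≈one (λ _ _ → refl)) (R.*-identityˡ f))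
                   , (λ f → R.trans {f ⊗ 𝟙} {f Z.⊛ Z.one} {f} (⊗⊛ {f} {f} {𝟙} {Z.one} (λ _ _ → refl) 𝟙≈one) (R.*-identityʳ f))
      ; distrib = (λ f g h n t → trans (⊗≈⊛ f (g ⊕ h) n t) (trans (R.distribˡ f g h n t) (sym (cong₂ ℤ._+_ (⊗≈⊛ f g n t) (⊗≈⊛ f h n t)))))
                , (λ f g h n t → trans (⊗≈⊛ (g ⊕ h) f n t) (trans (R.distribʳ f g h n t) (sym (cong₂ ℤ._+_ (⊗≈⊛ g f n t) (⊗≈⊛ h f n t)))))
      }
    ; *-comm = λ f g n t → trans (⊗≈⊛ f g n t) (trans (R.*-comm f g n t) (sym (⊗≈⊛ g f n t)))
    }
  }
  where
  module R = CommutativeRing Z.commutativeRing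
  ⊗⊛ : ∀ {f f′ g g′} → (∀ n t → f n t ≡ f′ n t) → (∀ n t → g n t ≡ g′ n t) → ∀ n t → (f ⊗ g) n t ≡ (f′ Z.⊛ g′) n t
  ⊗⊛ {f} {f′} {g} {g′} p q n t = trans (⊗≈⊛ f g n t) (R.*-cong {f} {f′} {g} {g′} p q n t)

module S = CommutativeRing seriesRing
open S using (_≈_)
open Exp S.semiring using (_^_)

sumTo-+ : ∀ n f g → sumTo n (λ k → f k ℤ.+ g k) ≡ sumTo n f ℤ.+ sumTo n g
sumTo-+ zero f g = refl
sumTo-+ (suc n) f g = trans (cong (ℤ._+ (f (suc n) ℤ.+ g (suc n))) (sumTo-+ n f g)) (swap (sumTo n f) _ _ _)
  where
  swap : ∀ a b c d → (a ℤ.+ b) ℤ.+ (c ℤ.+ d) ≡ (a ℤ.+ c) ℤ.+ (b ℤ.+ d)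
  swap = ℤSolver.solve-∀

sumTo-* : ∀ n a f → sumTo n (λ k → a ℤ.* f k) ≡ a ℤ.* sumTo n f
sumTo-* zero a f = refl
sumTo-* (suc n) a f = trans (cong (ℤ._+ a ℤ.* f (suc n)) (sumTo-* n a f)) (sym (ℤₚ.*-distribˡ-+ a (sumTo n f) (f (suc n))))

infixr 8 _∙_
_∙_ : ℤ → Series → Series
(a ∙ f) n t = a ℤ.* f n t

⊗-∙ : ∀ a f g → f ⊗ a ∙ g ≈ a ∙ (f ⊗ g)
⊗-∙ a f g n t = begin
  sumTo n (λ i → sumTo t (λ j → f i j ℤ.* (a ℤ.* g (n ∸ i) (t ∸ j))))
    ≡⟨ sumTo-cong n (λ i _ → trans (sumTo-cong t (λ j _ → swap (f i j) a _)) (sumTo-* t a _)) ⟩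
  sumTo n (λ i → a ℤ.* sumTo t (λ j → f i j ℤ.* g (n ∸ i) (t ∸ j)))
    ≡⟨ sumTo-* n a _ ⟩
  a ℤ.* (f ⊗ g) n t ∎
  where
  swap : ∀ x a y → x ℤ.* (a ℤ.* y) ≡ a ℤ.* (x ℤ.* y)
  swap = ℤSolver.solve-∀

∙-⊗ : ∀ a f g → a ∙ f ⊗ g ≈ a ∙ (f ⊗ g)
∙-⊗ a f g n t = trans (S.*-comm (a ∙ f) g n t) (trans (⊗-∙ a g f n t) (cong (a ℤ.*_) (S.*-comm g f n t)))

zS-shift-zero : ∀ f t → (zS ⊗ f) 0 t ≡ + 0
zS-shift-zero f t = trans (⊗≈⊛ zS f 0 t) (W.zero-⊛ (f 0) t)

zS-shift-suc : ∀ f n t → (zS ⊗ f) (suc n) t ≡ f n t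
zS-shift-suc f n t = begin
  (zS ⊗ f) (suc n) t   ≡⟨ ⊗≈⊛ zS f (suc n) t ⟩
  (zS Z.⊛ f) (suc n) t ≡⟨ cong₂ ℤ._+_ (W.zero-⊛ (f (suc n)) t) (Z.⊛-cong {zS ∘ suc} {Z.one} {f} {f} tail (λ _ _ → refl) n t) ⟩
  + 0 ℤ.+ (Z.one Z.⊛ f) n t ≡⟨ ℤₚ.+-identityˡ _ ⟩
  (Z.one Z.⊛ f) n t    ≡⟨ Z.⊛-identityˡ f n t ⟩
  f n t                ∎
  where
  tail : ∀ n t → zS (suc n) t ≡ Z.one n t
  tail zero zero = refl
  tail zero (suc t) = refl
  tail (suc n) t = refl

wS-⊗ : ∀ f n t → (wS ⊗ f) n t ≡ (wS 0 W.⊛ f n) t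
wS-⊗ f zero t = ⊗≈⊛ wS f 0 t
wS-⊗ f (suc n) t = trans (⊗≈⊛ wS f (suc n) t)
  (trans (cong (λ s → (wS 0 W.⊛ f (suc n)) t ℤ.+ s) (Z.zero-⊛ f n t)) (ℤₚ.+-identityʳ _))

wS-shift-zero : ∀ f n → (wS ⊗ f) n 0 ≡ + 0
wS-shift-zero f n = wS-⊗ f n 0

wS-shift-suc : ∀ f n t → (wS ⊗ f) n (suc t) ≡ f n t
wS-shift-suc f n t = begin
  (wS ⊗ f) n (suc t)                    ≡⟨ wS-⊗ f n (suc t) ⟩
  + 0 ℤ.+ ((wS 0 ∘ suc) W.⊛ f n) t      ≡⟨ ℤₚ.+-identityˡ _ ⟩
  ((wS 0 ∘ suc) W.⊛ f n) t              ≡⟨ W.⊛-cong {wS 0 ∘ suc} {W.one} {f n} {f n} tail (λ _ → refl) t ⟩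
  (W.one W.⊛ f n) t                     ≡⟨ W.⊛-identityˡ (f n) t ⟩
  f n t                                 ∎
  where
  tail : ∀ t → wS 0 (suc t) ≡ W.one t
  tail zero = refl
  tail (suc t) = refl

-- Composition of power series

infix 4 _≈[_]_
-- Congruence modulo z^N.
_≈[_]_ : Series → ℕ → Series → Set
f ≈[ N ] g = ∀ {n} t → n < N → f n t ≡ g n t

⊗-cong-[] : ∀ {N} h {f f′} → f ≈[ N ] f′ → h ⊗ f ≈[ N ] h ⊗ f′
⊗-cong-[] h f≈f′ {n} t n<N = sumTo-cong n (λ i _ → sumTo-cong t (λ j _ →
  cong (h i j ℤ.*_) (f≈f′ (t ∸ j) (ℕₚ.≤-<-trans (ℕₚ.m∸n≤m n i) n<N))))

zS-cong-[] : ∀ {N} {f f′} → f ≈[ N ] f′ → zS ⊗ f ≈[ suc N ] zS ⊗ f′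
zS-cong-[] {f = f} {f′} f≈f′ {zero} t _ = trans (zS-shift-zero f t) (sym (zS-shift-zero f′ t))
zS-cong-[] {f = f} {f′} f≈f′ {suc n} t (s≤s n<N) = trans (zS-shift-suc f n t) (trans (f≈f′ t n<N) (sym (zS-shift-suc f′ n t)))

-- `Cat∘` is the case `cat`; general coefficients are needed because peeling off the constant term
-- shifts the sequence.
comp : (ℕ → ℤ) → Series → Series
comp c g n t = sumTo n (λ k → c k ℤ.* pow g k n t)

⊗-sumTo : ∀ N g (c : ℕ → ℤ) (F : ℕ → Series) →
  g ⊗ (λ n t → sumTo N (λ k → c k ℤ.* F k n t)) ≈ λ n t → sumTo N (λ k → c k ℤ.* (g ⊗ F k) n t)
⊗-sumTo zero g c F = ⊗-∙ (c 0) g (F 0)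
⊗-sumTo (suc N) g c F n t = trans (S.distribˡ g (λ n t → sumTo N (λ k → c k ℤ.* F k n t)) (c (suc N) ∙ F (suc N)) n t)
  (cong₂ ℤ._+_ (⊗-sumTo N g c F n t) (⊗-∙ (c (suc N)) g (F (suc N)) n t))

comp-linear : ∀ a d e g → comp (λ k → a ℤ.* d k ℤ.+ e k) g ≈ a ∙ comp d g ⊕ comp e g
comp-linear a d e g n t = begin
  sumTo n (λ k → (a ℤ.* d k ℤ.+ e k) ℤ.* pow g k n t)
    ≡⟨ sumTo-cong n (λ k _ → expand a (d k) (e k) _) ⟩
  sumTo n (λ k → a ℤ.* (d k ℤ.* pow g k n t) ℤ.+ e k ℤ.* pow g k n t)
    ≡⟨ sumTo-+ n _ _ ⟩
  sumTo n (λ k → a ℤ.* (d k ℤ.* pow g k n t)) ℤ.+ comp e g n t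
    ≡⟨ cong (ℤ._+ comp e g n t) (sumTo-* n a _) ⟩
  a ℤ.* comp d g n t ℤ.+ comp e g n t ∎
  where
  expand : ∀ a d e p → (a ℤ.* d ℤ.+ e) ℤ.* p ≡ a ℤ.* (d ℤ.* p) ℤ.+ e ℤ.* p
  expand = ℤSolver.solve-∀

module _ (g h : Series) (g≈zh : g ≈ zS ⊗ h) where

  -- The factor z in `g` gains one order of precision.
  raise : ∀ {N f f′} → f ≈[ N ] f′ → g ⊗ f ≈[ suc N ] g ⊗ f′
  raise {N} {f} {f′} f≈f′ {n} t n<N = begin
    (g ⊗ f) n t           ≡⟨ factor f n t ⟩
    (zS ⊗ (h ⊗ f)) n t    ≡⟨ zS-cong-[] {N} {h ⊗ f} {h ⊗ f′} (⊗-cong-[] h f≈f′) t n<N ⟩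
    (zS ⊗ (h ⊗ f′)) n t   ≡⟨ factor f′ n t ⟨
    (g ⊗ f′) n t          ∎
    where
    factor : ∀ f → g ⊗ f ≈ zS ⊗ (h ⊗ f)
    factor f n t = trans (S.*-congʳ {f} {g} {zS ⊗ h} g≈zh n t) (S.*-assoc zS h f n t)

  pow-order : ∀ k {n} t → n < k → pow g k n t ≡ + 0
  pow-order (suc k) {n} t n<k = trans (raise {k} {pow g k} {λ _ _ → + 0} (pow-order k) t n<k) (S.zeroʳ g n t)

  -- A Horner step. The summation bound in `comp` moves with the degree, so the sum is first
  -- extended by a vanishing term; under `g`, where only lower degrees count, the fixed bound is
  -- then exchanged for the moving one.
  comp-head : ∀ c → comp c g ≈ c 0 ∙ 𝟙 ⊕ g ⊗ comp (c ∘ suc) g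
  comp-head c n t = begin
    sumTo n (λ k → c k ℤ.* pow g k n t)
      ≡⟨ sumTo-stable {n} {suc n} (λ k → c k ℤ.* pow g k n t) (ℕₚ.n≤1+n n) (vanish c) ⟨
    sumTo (suc n) (λ k → c k ℤ.* pow g k n t)
      ≡⟨ sumTo-head n (λ k → c k ℤ.* pow g k n t) ⟩
    c 0 ℤ.* 𝟙 n t ℤ.+ sumTo n (λ k → c (suc k) ℤ.* (g ⊗ pow g k) n t)
      ≡⟨ cong (λ s → c 0 ℤ.* 𝟙 n t ℤ.+ s) (⊗-sumTo n g (c ∘ suc) (pow g) n t) ⟨
    c 0 ℤ.* 𝟙 n t ℤ.+ (g ⊗ (λ n′ t → sumTo n (λ k → c (suc k) ℤ.* pow g k n′ t))) n t
      ≡⟨ cong (λ s → c 0 ℤ.* 𝟙 n t ℤ.+ s) (raise {n} {λ n′ t → sumTo n (λ k → c (suc k) ℤ.* pow g k n′ t)} {comp (c ∘ suc) g}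
           (λ {n′} t n′<n → sumTo-stable {n′} {n} (λ k → c (suc k) ℤ.* pow g k n′ t) (ℕₚ.<⇒≤ n′<n) (vanish (c ∘ suc))) t ℕₚ.≤-refl) ⟩
    c 0 ℤ.* 𝟙 n t ℤ.+ (g ⊗ comp (c ∘ suc) g) n t ∎
    where
    vanish : ∀ (c : ℕ → ℤ) {n t} k → n < k → c k ℤ.* pow g k n t ≡ + 0
    vanish c {t = t} k n<k = trans (cong (c k ℤ.*_) (pow-order k t n<k)) (ℤₚ.*-zeroʳ (c k))

  -- Coefficient sequences never run out, so the induction is on the precision: a Horner step on `c`
  -- leaves the product of the shifted `c` with `d` under a factor `g`, which raises the precision
  -- by one.
  comp-⊛ : ∀ N c d → comp (c W.⊛ d) g ≈[ N ] comp c g ⊗ comp d g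
  comp-⊛ (suc N) c d {n} t n<N = begin
    comp (c W.⊛ d) g n t
      ≡⟨ comp-head (c W.⊛ d) n t ⟩
    c 0 ℤ.* d 0 ℤ.* 𝟙 n t ℤ.+ (g ⊗ comp ((c W.⊛ d) ∘ suc) g) n t
      ≡⟨ cong (λ s → c 0 ℤ.* d 0 ℤ.* 𝟙 n t ℤ.+ s) (tail n t) ⟩
    c 0 ℤ.* d 0 ℤ.* 𝟙 n t ℤ.+ (c 0 ℤ.* (g ⊗ D′) n t ℤ.+ (g ⊗ comp (c′ W.⊛ d) g) n t)
      ≡⟨ cong (λ s → c 0 ℤ.* d 0 ℤ.* 𝟙 n t ℤ.+ (c 0 ℤ.* (g ⊗ D′) n t ℤ.+ s))
           (raise {N} {comp (c′ W.⊛ d) g} {C′ ⊗ D} (comp-⊛ N c′ d) t n<N) ⟩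
    c 0 ℤ.* d 0 ℤ.* 𝟙 n t ℤ.+ (c 0 ℤ.* (g ⊗ D′) n t ℤ.+ (g ⊗ (C′ ⊗ D)) n t)
      ≡⟨ factor (c 0) (d 0) (𝟙 n t) _ _ ⟩
    c 0 ℤ.* (d 0 ℤ.* 𝟙 n t ℤ.+ (g ⊗ D′) n t) ℤ.+ (g ⊗ (C′ ⊗ D)) n t
      ≡⟨ cong₂ (λ a b → c 0 ℤ.* a ℤ.+ b) (comp-head d n t) (S.*-assoc g C′ D n t) ⟨
    c 0 ℤ.* D n t ℤ.+ ((g ⊗ C′) ⊗ D) n t
      ≡⟨ cong (λ a → c 0 ℤ.* a ℤ.+ ((g ⊗ C′) ⊗ D) n t) (S.*-identityˡ D n t) ⟨
    c 0 ℤ.* (𝟙 ⊗ D) n t ℤ.+ ((g ⊗ C′) ⊗ D) n t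
      ≡⟨ cong (ℤ._+ ((g ⊗ C′) ⊗ D) n t) (∙-⊗ (c 0) 𝟙 D n t) ⟨
    (c 0 ∙ 𝟙 ⊗ D) n t ℤ.+ ((g ⊗ C′) ⊗ D) n t
      ≡⟨ S.distribʳ D (c 0 ∙ 𝟙) (g ⊗ C′) n t ⟨
    ((c 0 ∙ 𝟙 ⊕ g ⊗ C′) ⊗ D) n t
      ≡⟨ S.*-congʳ {D} {comp c g} {c 0 ∙ 𝟙 ⊕ g ⊗ C′} (comp-head c) n t ⟨
    (comp c g ⊗ D) n t ∎
    where
    c′ = c ∘ suc
    C′ = comp c′ g
    D = comp d g
    D′ = comp (d ∘ suc) g
    tail : g ⊗ comp ((c W.⊛ d) ∘ suc) g ≈ c 0 ∙ (g ⊗ D′) ⊕ g ⊗ comp (c′ W.⊛ d) g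
    tail n t = begin
      (g ⊗ comp ((c W.⊛ d) ∘ suc) g) n t
        ≡⟨ S.*-congˡ {g} {comp ((c W.⊛ d) ∘ suc) g} {c 0 ∙ D′ ⊕ comp (c′ W.⊛ d) g} (comp-linear (c 0) (d ∘ suc) (c′ W.⊛ d) g) n t ⟩
      (g ⊗ (c 0 ∙ D′ ⊕ comp (c′ W.⊛ d) g)) n t
        ≡⟨ S.distribˡ g (c 0 ∙ D′) (comp (c′ W.⊛ d) g) n t ⟩
      (g ⊗ c 0 ∙ D′) n t ℤ.+ (g ⊗ comp (c′ W.⊛ d) g) n t
        ≡⟨ cong (ℤ._+ (g ⊗ comp (c′ W.⊛ d) g) n t) (⊗-∙ (c 0) g D′ n t) ⟩
      c 0 ℤ.* (g ⊗ D′) n t ℤ.+ (g ⊗ comp (c′ W.⊛ d) g) n t ∎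
    factor : ∀ c d i x y → c ℤ.* d ℤ.* i ℤ.+ (c ℤ.* x ℤ.+ y) ≡ c ℤ.* (d ℤ.* i ℤ.+ x) ℤ.+ y
    factor = ℤSolver.solve-∀

  -- By the convolution the shifted Catalan sequence is the square of the sequence, so the Horner
  -- step becomes the quadratic equation.
  Cat∘-quadratic : Cat∘ g ≈ 𝟙 ⊕ g ⊗ (Cat∘ g ⊗ Cat∘ g)
  Cat∘-quadratic n t = begin
    Cat∘ g n t
      ≡⟨ comp-head cat n t ⟩
    + 1 ℤ.* 𝟙 n t ℤ.+ (g ⊗ comp (cat ∘ suc) g) n t
      ≡⟨ cong₂ ℤ._+_ (ℤₚ.*-identityˡ (𝟙 n t)) (S.*-congˡ {g} {comp (cat ∘ suc) g} {Cat∘ g ⊗ Cat∘ g} square n t) ⟩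
    𝟙 n t ℤ.+ (g ⊗ (Cat∘ g ⊗ Cat∘ g)) n t ∎
    where
    square : comp (cat ∘ suc) g ≈ Cat∘ g ⊗ Cat∘ g
    square n t = trans (sumTo-cong n (λ k _ → cong (ℤ._* pow g k n t) (catalan-convolution k))) (comp-⊛ (suc n) cat cat t ℕₚ.≤-refl)

-- Extraction of coefficients

module DS = DescentSeries seriesRing
open DS using (∑)

descentGF : ℕ → Series
descentGF = DS.descentGF zS wS

Ψ : ℕ → Series → Series
Ψ = DS.Ψ zS wS

zS-^-order : ∀ m u {n} t → n < m → (zS ^ m ⊗ u) n t ≡ + 0
zS-^-order (suc m) u {zero} t _ = trans (S.*-assoc zS (zS ^ m) u 0 t) (zS-shift-zero (zS ^ m ⊗ u) t)
zS-^-order (suc m) u {suc n} t (s≤s n<m) =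
  trans (S.*-assoc zS (zS ^ m) u (suc n) t) (trans (zS-shift-suc (zS ^ m ⊗ u) n t) (zS-^-order m u t n<m))

zS-^-shift : ∀ m u n t → (zS ^ m ⊗ u) (m ℕ.+ n) t ≡ u n t
zS-^-shift zero u n t = S.*-identityˡ u n t
zS-^-shift (suc m) u n t =
  trans (S.*-assoc zS (zS ^ m) u (suc m ℕ.+ n) t) (trans (zS-shift-suc (zS ^ m ⊗ u) (m ℕ.+ n) t) (zS-^-shift m u n t))

wS-^-order : ∀ m u n {t} → t < m → (wS ^ m ⊗ u) n t ≡ + 0
wS-^-order (suc m) u n {zero} _ = trans (S.*-assoc wS (wS ^ m) u n 0) (wS-shift-zero (wS ^ m ⊗ u) n)
wS-^-order (suc m) u n {suc t} (s≤s t<m) =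
  trans (S.*-assoc wS (wS ^ m) u n (suc t)) (trans (wS-shift-suc (wS ^ m ⊗ u) n t) (wS-^-order m u n t<m))

wS-^-suc : ∀ k n t → (wS ^ k) (suc n) t ≡ + 0
wS-^-suc zero n t = refl
wS-^-suc (suc k) n zero = wS-shift-zero (wS ^ k) (suc n)
wS-^-suc (suc k) n (suc t) = trans (wS-shift-suc (wS ^ k) (suc n) t) (wS-^-suc k n t)

wS-^-self : ∀ k → (wS ^ k) 0 k ≡ + 1
wS-^-self zero = refl
wS-^-self (suc k) = trans (wS-shift-suc (wS ^ k) 0 k) (wS-^-self k)

wS-^-≢ : ∀ {k t} → k ≢ t → (wS ^ k) 0 t ≡ + 0
wS-^-≢ {zero} {zero} k≢t = contradiction refl k≢t
wS-^-≢ {zero} {suc t} _ = refl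
wS-^-≢ {suc k} {zero} _ = wS-shift-zero (wS ^ k) 0
wS-^-≢ {suc k} {suc t} k≢t = trans (wS-shift-suc (wS ^ k) 0 t) (wS-^-≢ (k≢t ∘ cong suc))

∑-wS-^-suc : ∀ {A : Set} (s : A → ℕ) xs n t → ∑ xs (λ x → wS ^ s x) (suc n) t ≡ + 0
∑-wS-^-suc s [] n t = refl
∑-wS-^-suc s (x ∷ xs) n t = cong₂ ℤ._+_ (wS-^-suc (s x) n t) (∑-wS-^-suc s xs n t)

∑-wS-^-count : ∀ {A : Set} (s : A → ℕ) xs t →
  ∑ xs (λ x → wS ^ s x) 0 t ≡ + length (filter (λ x → s x ℕ.≟ t) xs)
∑-wS-^-count s [] t = refl
∑-wS-^-count s (x ∷ xs) t with s x ℕ.≟ t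
... | yes refl = trans (cong₂ ℤ._+_ (wS-^-self (s x)) (∑-wS-^-count s xs t))
  (cong (+_ ∘ length) (sym (Listₚ.filter-accept (λ x → s x ℕ.≟ t) {x} {xs} refl)))
... | no ≢t = trans (cong₂ ℤ._+_ (wS-^-≢ ≢t) (∑-wS-^-count s xs t))
  (trans (ℤₚ.+-identityˡ _) (cong (+_ ∘ length) (sym (Listₚ.filter-reject (λ x → s x ℕ.≟ t) {x} {xs} ≢t))))

T-descentGF : ∀ n t → + T n t ≡ descentGF n 0 t
T-descentGF n t = begin
  + length (filter (λ π → tier π ℕ.≟ t) (perms n))
    ≡⟨ cong +_ (↭-length (filter-↭ (λ π → tier π ℕ.≟ t) (perms-↭ n))) ⟩
  + length (filter (λ π → tier π ℕ.≟ t) (map (build 1) (allInversions n)))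
    ≡⟨ ∑-wS-^-count tier (map (build 1) (allInversions n)) t ⟨
  ∑ (map (build 1) (allInversions n)) (λ π → wS ^ tier π) 0 t
    ≡⟨ cong (λ f → f 0 t) (DS.∑-map (build 1) (allInversions n) (λ π → wS ^ tier π)) ⟩
  ∑ (allInversions n) (λ es → wS ^ tier (build 1 es)) 0 t
    ≡⟨ DS.∑-cong (allInversions n) {λ es → wS ^ tier (build 1 es)} {λ es → wS ^ descents es}
         (λ es n t → cong (λ k → (wS ^ k) n t) (tier-build es)) 0 t ⟩
  descentGF n 0 t ∎

-- The `𝟙` is the empty permutation, which `Ψ` includes and `Tseries` omits; it cancels against the
-- 1 in `Ψ-iterated`.
descentGF-Tseries : ∀ n t → descentGF n 0 t ≡ 𝟙 n t ℤ.+ Tseries n t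
descentGF-Tseries zero t = refl
descentGF-Tseries (suc n) t = trans (sym (T-descentGF (suc n) t)) (sym (ℤₚ.+-identityˡ _))

Ψ-term : ∀ m → descentGF m ⊗ (zS ^ m ⊗ 𝟙 ^ suc m) ≈ zS ^ m ⊗ descentGF m
Ψ-term m = DS.*-one-^ (descentGF m) (zS ^ m) (suc m)

-- Descent polynomials are free of z, so at X = 1 the summand of index k lives in degree k alone.
Ψ-coefficient-≥ : ∀ {m n} t → m ≤ n → Ψ m 𝟙 n t ≡ + 0
Ψ-coefficient-≥ {zero} t _ = refl
Ψ-coefficient-≥ {suc m} {n} t m<n = cong₂ ℤ._+_ (Ψ-coefficient-≥ t (ℕₚ.<⇒≤ m<n)) (trans (Ψ-term m n t) term)
  where
  term : (zS ^ m ⊗ descentGF m) n t ≡ + 0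
  term = begin
    (zS ^ m ⊗ descentGF m) n t                          ≡⟨ cong (λ k → (zS ^ m ⊗ descentGF m) k t) n≡ ⟩
    (zS ^ m ⊗ descentGF m) (m ℕ.+ suc (n ∸ suc m)) t    ≡⟨ zS-^-shift m (descentGF m) (suc (n ∸ suc m)) t ⟩
    descentGF m (suc (n ∸ suc m)) t                     ≡⟨ ∑-wS-^-suc descents (allInversions m) (n ∸ suc m) t ⟩
    + 0                                                 ∎
    where
    n≡ : n ≡ m ℕ.+ suc (n ∸ suc m)
    n≡ = trans (sym (ℕₚ.m+[n∸m]≡n m<n)) (sym (ℕₚ.+-suc m (n ∸ suc m)))

Ψ-coefficient : ∀ {m n} t → n < m → Ψ m 𝟙 n t ≡ descentGF n 0 t
Ψ-coefficient {suc m} {n} t n<1+m with ℕₚ.m≤n⇒m<n∨m≡n (ℕₚ.≤-pred n<1+m)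
... | inj₁ n<m = trans (cong₂ ℤ._+_ (Ψ-coefficient t n<m) (trans (Ψ-term m n t) (zS-^-order m (descentGF m) t n<m))) (ℤₚ.+-identityʳ _)
... | inj₂ refl = trans (cong₂ ℤ._+_ (Ψ-coefficient-≥ {n} t ℕₚ.≤-refl) (trans (Ψ-term n n t) term)) (ℤₚ.+-identityˡ _)
  where
  term : (zS ^ n ⊗ descentGF n) n t ≡ descentGF n 0 t
  term = trans (cong (λ k → (zS ^ n ⊗ descentGF n) k t) (sym (ℕₚ.+-identityʳ n))) (zS-^-shift n (descentGF n) 0 t)

ρ-quadratic : ∀ j → ρ j ≈ 𝟙 ⊕ zS ⊗ (𝟙 ⊖ wS) ⊗ P j ⊗ (ρ j ⊗ ρ j)
ρ-quadratic j = Cat∘-quadratic (zS ⊗ (𝟙 ⊖ wS) ⊗ P j) ((𝟙 ⊖ wS) ⊗ P j) (S.*-assoc zS (𝟙 ⊖ wS) (P j))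

pow-^ : ∀ f k → pow f k ≡ f ^ k
pow-^ f zero = refl
pow-^ f (suc k) = cong (f ⊗_) (pow-^ f k)

module _ (r p : ℕ → Series) (p-zero : p 0 ≈ 𝟙) (p-suc : ∀ j → p (suc j) ≈ p j ⊗ r j)
         (r-quadratic : ∀ j → r j ≈ 𝟙 ⊕ zS ⊗ (𝟙 ⊖ wS) ⊗ p j ⊗ (r j ⊗ r j)) where

  partialSum : ℕ → Series
  partialSum = DS.partialSum zS wS r p p-zero p-suc r-quadratic

  partialSum-sumTo : ∀ J n t → partialSum (suc J) n t ≡ sumTo J (λ j → ((r j ⊖ 𝟙) ⊗ pow wS j ⊗ p j) n t)
  partialSum-sumTo zero n t = ℤₚ.+-identityˡ _
  partialSum-sumTo (suc J) n t = cong₂ ℤ._+_ (partialSum-sumTo J n t)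
    (cong (λ a → ((r (suc J) ⊖ 𝟙) ⊗ a ⊗ p (suc J)) n t) (sym (pow-^ wS (suc J))))

  Tseries-sumTo : ∀ n t → Tseries n t ≡ sumTo t (λ j → ((r j ⊖ 𝟙) ⊗ pow wS j ⊗ p j) n t)
  -- Truncation at z^(n+1) and t + 1 iterations are just enough: both the error and the tail vanish
  -- at z^n w^t, and the partial sum ends at j = t.
  Tseries-sumTo n t = let u , eq = DS.Ψ-iterated zS wS r p p-zero p-suc r-quadratic n (suc t) in
    ∙-cancelˡ (𝟙 n t) (Tseries n t) (sumTo t (λ j → ((r j ⊖ 𝟙) ⊗ pow wS j ⊗ p j) n t)) (begin
      𝟙 n t ℤ.+ Tseries n t      ≡⟨ descentGF-Tseries n t ⟨
      descentGF n 0 t            ≡⟨ Ψ-coefficient {suc n} {n} t ℕₚ.≤-refl ⟨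
      Ψ (suc n) 𝟙 n t            ≡⟨ eq n t ⟩
      𝟙 n t ℤ.+ partialSum (suc t) n t
        ℤ.+ (wS ^ suc t ⊗ (Ψ (suc n) (p (suc t)) S.- p (suc t))) n t ℤ.+ (zS ^ suc n ⊗ u) n t
        ≡⟨ cong₂ (λ a b → 𝟙 n t ℤ.+ partialSum (suc t) n t ℤ.+ a ℤ.+ b)
             (wS-^-order (suc t) (Ψ (suc n) (p (suc t)) S.- p (suc t)) n ℕₚ.≤-refl) (zS-^-order (suc n) u t ℕₚ.≤-refl) ⟩
      𝟙 n t ℤ.+ partialSum (suc t) n t ℤ.+ + 0 ℤ.+ + 0
        ≡⟨ trans (ℤₚ.+-identityʳ (𝟙 n t ℤ.+ partialSum (suc t) n t ℤ.+ + 0)) (ℤₚ.+-identityʳ (𝟙 n t ℤ.+ partialSum (suc t) n t)) ⟩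
      𝟙 n t ℤ.+ partialSum (suc t) n t
        ≡⟨ cong (λ s → 𝟙 n t ℤ.+ s) (partialSum-sumTo t n t) ⟩
      𝟙 n t ℤ.+ sumTo t (λ j → ((r j ⊖ 𝟙) ⊗ pow wS j ⊗ p j) n t) ∎)
    where open GroupProperties (AbelianGroup.group ℤₚ.+-0-abelianGroup) using (∙-cancelˡ)

theorem4p11 : (n t : ℕ) → Tseries n t ≡ RHS n t
theorem4p11 = Tseries-sumTo ρ P (λ _ _ → refl) (λ j n t → refl) ρ-quadratic
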